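{- Let $v\in S_n$ be vexillary. The map $\gamma:\mathsf{FSYT}(v)\to\mathsf{Pipes}(v)$, which sends $T\in\mathsf{FSYT}(v)$ to the unique $\mathcal P\in\mathsf{Pipes}(v)$ with $$D(\mathcal P)=\{(T(i,j),\,T(i,j)-i+j):(i,j)\in\mathbb Y(\mu^{(v)})\},$$ is a bijection (in particular, such a unique $\mathcal P$ exists for each $T$).
   Context: A permutation $v\in S_n$ is vexillary if there are no $i_1<i_2<i_3<i_4$ with $v_{i_2}<v_{i_1}<v_{i_4}<v_{i_3}$ (it avoids $2143$). Bumpless pipe dreams. Cells $(i,j)$ of the $n\times n$ grid: row $i$ from the top, column $j$ from the left. There are six tiles: downward elbow (a pipe joining the bottom and right edges), upward elbow (a pipe joining the left and top edges), crossing (one pipe joining left and right edges and one joining bottom and top edges), blank (no pipe), horizontal (left to right), vertical (bottom to top). A bumpless pipe dream (BPD) of size $n$ is a tiling of the grid by these tiles such that an edge shared by two cells is met by a pipe from both sides or from neither, every bottom and right boundary edge is met by a pipe, and no left or top boundary edge is met by a pipe. $D(\mathcal P)$ is the set of positions of blank tiles. Demazure product $\partial(\mathcal P)\in S_n$: label the bottom boundary edges $1,\dots,n$ from left to right and propagate labels along pipes north and east; at a crossing tile, of the two labels entering from the left and from below, the smaller leaves through the right edge and the larger through the top edge. $\partial(\mathcal P)(i)$ is the label arriving at the right boundary edge of row $i$. $\mathsf{Pipes}(v)=\{\mathcal P:\partial(\mathcal P)=v\}$. For a partition $\lambda$, $\mathbb Y(\lambda)=\{(i,j):1\le j\le\lambda_i\}$.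 The Rothe diagram is $D(v)=\{(i,j):v_i>j,\ v^{ -1}(j)>i\}$ and the Lehmer code is $\mathsf c_v(i)=|\{j:(i,j)\in D(v)\}|$. $\mu^{(v)}$ is the partition obtained by sorting the entries of $\mathsf c_v$ into weakly decreasing order; $\lambda^{(v)}$ is the partition with $\mathbb Y(\lambda^{(v)})=\bigcup_{(i,j)\in D(v)}[1,i]\times[1,j]$. The flag $\mathbf f^{(v)}$: $f^{(v)}_i$ is the maximal row index $j$ with $(j,\,j-i+\mu^{(v)}_i)\in\mathbb Y(\lambda^{(v)})$. $\mathsf{FSYT}(v)$ is the set of semistandard tableaux $T:\mathbb Y(\mu^{(v)})\to\{1,2,\dots\}$ (weakly increasing along rows left to right, strictly increasing down columns) that are flagged by $\mathbf f^{(v)}$, i.e. $T(i,j)\le f^{(v)}_i$ for all $(i,j)\in\mathbb Y(\mu^{(v)})$. -}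

module Defs where

open import Level using (0ℓ)
open import Data.Bool using (Bool; true; false; if_then_else_)
open import Data.Fin using (Fin; toℕ; _<_; _<?_; _≤?_)
open import Data.Fin.Permutation using (Permutation′; _⟨$⟩ʳ_; _⟨$⟩ˡ_)
open import Data.Fin.Properties using (toℕ<n)
open import Data.List as List using (List; []; _∷_; length; map; filter; allFin; cartesianProduct; upTo)
open import Data.List.Extrema.Nat using (max; argmax-sel; xs≤max)
open import Data.List.Membership.Propositional using () renaming (_∈_ to _∈ₗ_)
open import Data.List.Membership.Propositional.Properties
  using (∈-map⁺; ∈-map⁻; ∈-filter⁺; ∈-filter⁻; ∈-cartesianProduct⁺; ∈-allFin; ∈-upTo⁺)
import Data.List.Relation.Unary.All as All
open import Data.List.Sort using (sort)
open import Data.Maybe using (Maybe; just; nothing)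
open import Data.Nat as ℕ using (ℕ; suc; _+_; _∸_; _≤_; z≤n; s≤s)
import Data.Nat.Properties as ℕₚ
open import Data.Product using (∃; ∃-syntax; _×_; _,_; proj₁; proj₂)
open import Data.Sum using (_⊎_; inj₁; inj₂)
open import Data.Vec as Vec using (Vec; []; _∷_; lookup)
open import Function using (id)
open import Relation.Binary.Bundles using (Setoid)
import Relation.Binary.Construct.Flip.EqAndOrd as Flip
open import Relation.Binary.PropositionalEquality using (_≡_; refl; sym; trans; subst)
open import Relation.Nullary using (¬_; does)
open import Relation.Nullary.Decidable using (_×-dec_)
open import Relation.Unary using (Pred; Decidable; _∈_; _≐_)

------------------------------------------------------------------------
-- Coordinates

-- Cells are in matrix coordinates and, like tableau entries, numbered
-- from 1.  An n × n grid is indexed by Fin n, whose element i stands for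
-- the number pos i ∈ {1, …, n}.

Cell : Set
Cell = ℕ × ℕ

pos : ∀ {n} → Fin n → ℕ
pos i = suc (toℕ i)

cells : ∀ {n} → Pred (Fin n × Fin n) 0ℓ → Pred Cell 0ℓ
cells S (r , c) = ∃[ i ] ∃[ j ] (i , j) ∈ S × pos i ≡ r × pos j ≡ c

------------------------------------------------------------------------
-- Permutations

Vexillary : ∀ {n} → Permutation′ n → Set
Vexillary v = ∀ {i₁ i₂ i₃ i₄} → i₁ < i₂ → i₂ < i₃ → i₃ < i₄ →
  ¬ (v ⟨$⟩ʳ i₂ < v ⟨$⟩ʳ i₁ × v ⟨$⟩ʳ i₁ < v ⟨$⟩ʳ i₄ × v ⟨$⟩ʳ i₄ < v ⟨$⟩ʳ i₃)

Rothe : ∀ {n} → Permutation′ n → Pred (Fin n × Fin n) 0ℓ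
Rothe v (i , j) = j < v ⟨$⟩ʳ i × i < v ⟨$⟩ˡ j

rothe? : ∀ {n} (v : Permutation′ n) → Decidable (Rothe v)
rothe? v (i , j) = (j <? v ⟨$⟩ʳ i) ×-dec (i <? v ⟨$⟩ˡ j)

rotheList : ∀ {n} → Permutation′ n → List (Fin n × Fin n)
rotheList {n} v = filter (rothe? v) (cartesianProduct (allFin n) (allFin n))

code : ∀ {n} → Permutation′ n → Fin n → ℕ
code {n} v i = length (filter (λ j → rothe? v (i , j)) (allFin n))

------------------------------------------------------------------------
-- Partitions

-- A partition is given by its parts λ 1, λ 2, …; the value at 0 carries
-- no meaning.

Y : (ℕ → ℕ) → Pred Cell 0ℓ
Y lam (i , j) = 1 ≤ i × 1 ≤ j × j ≤ lam i

Y? : ∀ lam → Decidable (Y lam)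
Y? lam (i , j) = (1 ℕ.≤? i) ×-dec ((1 ℕ.≤? j) ×-dec (j ℕ.≤? lam i))

parts : List ℕ → ℕ → ℕ
parts []       _             = 0
parts (x ∷ xs) 0             = 0
parts (x ∷ xs) 1             = x
parts (x ∷ xs) (suc (suc i)) = parts xs (suc i)

mu : ∀ {n} → Permutation′ n → ℕ → ℕ
mu v = parts (sort (Flip.decTotalOrder ℕₚ.≤-decTotalOrder) (List.tabulate (code v)))

maxℕ : List ℕ → ℕ
maxℕ = max 0

lam : ∀ {n} → Permutation′ n → ℕ → ℕ
lam v r = maxℕ (map (λ (_ , j) → pos j) (filter (λ (i , _) → r ℕ.≤? pos i) (rotheList v)))

-- The largest row j with (j , j - i + μᵢ) in Y (lam v), or 0 if there is
-- no such row.  Truncated subtraction is harmless: it yields 0 when the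
-- integer j - i + μᵢ is not positive, and columns start at 1.
flag : ∀ {n} → Permutation′ n → ℕ → ℕ
flag {n} v i = maxℕ (filter (λ j → Y? (lam v) (j , j + mu v i ∸ i)) (upTo (suc n)))

-- lam and flag have their defining properties: Y (lam v) is the union of
-- the rectangles [1,i] × [1,j] with (i,j) in the Rothe diagram, and
-- flag v i is maximal as described above.

private
  maxℕ-∈ : ∀ xs → 1 ≤ maxℕ xs → maxℕ xs ∈ₗ xs
  maxℕ-∈ xs 1≤m with argmax-sel id 0 xs
  ... | inj₂ m∈xs = m∈xs
  ... | inj₁ m≡0 with () ← subst (1 ≤_) m≡0 1≤m

  ≤-maxℕ : ∀ {x} xs → x ∈ₗ xs → x ≤ maxℕ xs
  ≤-maxℕ xs = All.lookup (xs≤max 0 xs)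

Y-lam : ∀ {n} (v : Permutation′ n) →
  Y (lam v) ≐ λ (r , c) → ∃[ i ] ∃[ j ] (i , j) ∈ cells (Rothe v) ×
                            (1 ≤ r × r ≤ i) × (1 ≤ c × c ≤ j)
Y-lam {n} v = to , from
  where
  to : ∀ {x} → x ∈ Y (lam v) → _
  to {r , c} (1≤r , 1≤c , c≤)
    with (i , j) , ij∈ , eq ← ∈-map⁻ (λ ((_ , j) : Fin n × Fin n) → pos j) (maxℕ-∈ _ (ℕₚ.≤-trans 1≤c c≤))
    with ij∈D , r≤i ← ∈-filter⁻ (λ ((i , _) : Fin n × Fin n) → r ℕ.≤? pos i) {xs = rotheList v} ij∈
    with _ , D ← ∈-filter⁻ (rothe? v) {xs = cartesianProduct (allFin n) (allFin n)} ij∈D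
    = pos i , pos j , (i , j , D , refl , refl) , (1≤r , r≤i) , (1≤c , subst (c ≤_) eq c≤)
  from : ∀ {x} → _ → x ∈ Y (lam v)
  from {r , c} (_ , _ , (i , j , D , refl , refl) , (1≤r , r≤i) , (1≤c , c≤j)) =
    1≤r , 1≤c , ℕₚ.≤-trans c≤j (≤-maxℕ _ (∈-map⁺ _ (∈-filter⁺ (λ (i , _) → r ℕ.≤? pos i)
      (∈-filter⁺ (rothe? v) (∈-cartesianProduct⁺ (∈-allFin i) (∈-allFin j)) D) r≤i)))

flag-upper : ∀ {n} (v : Permutation′ n) i j →
  (j , j + mu v i ∸ i) ∈ Y (lam v) → j ≤ flag v i
flag-upper {n} v i j p with i′ , _ , (k , _ , _ , refl , _) , (_ , j≤) , _ ← proj₁ (Y-lam v) p =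
  ≤-maxℕ _ (∈-filter⁺ (λ j → Y? (lam v) (j , j + mu v i ∸ i))
    (∈-upTo⁺ (s≤s (ℕₚ.≤-trans j≤ (toℕ<n k)))) p)

flag-∈ : ∀ {n} (v : Permutation′ n) i j → (j , j + mu v i ∸ i) ∈ Y (lam v) →
  (flag v i , flag v i + mu v i ∸ i) ∈ Y (lam v)
flag-∈ {n} v i j p = proj₂ (∈-filter⁻ (λ j → Y? (lam v) (j , j + mu v i ∸ i)) {xs = upTo (suc n)}
  (maxℕ-∈ _ (ℕₚ.≤-trans (proj₁ p) (flag-upper v i j p))))

------------------------------------------------------------------------
-- Flagged semistandard tableaux

record Tableau {n} (v : Permutation′ n) : Set where
  field
    entry      : ∃ (Y (mu v)) → ℕ
    positive   : ∀ b → 1 ≤ entry b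
    row-weak   : ∀ {i j j′} p q → j ≤ j′ → entry ((i , j) , p) ≤ entry ((i , j′) , q)
    col-strict : ∀ {i i′ j} p q → i ℕ.< i′ → entry ((i , j) , p) ℕ.< entry ((i′ , j) , q)
    flagged    : ∀ {i j} p → entry ((i , j) , p) ≤ flag v i

open Tableau public

FSYT : ∀ {n} → Permutation′ n → Setoid 0ℓ 0ℓ
FSYT v = record
  { Carrier       = Tableau v
  ; _≈_           = λ T U → ∀ b → entry T b ≡ entry U b
  ; isEquivalence = record
    { refl  = λ _ → refl
    ; sym   = λ e b → sym (e b)
    ; trans = λ e f b → trans (e b) (f b)
    }
  }

-- The cells (T(i,j) , T(i,j) - i + j); writing the column c as
-- c + i ≡ T(i,j) + j avoids subtraction.
positions : ∀ {n} {v : Permutation′ n} → Tableau v → Pred Cell 0ℓ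
positions T (r , c) = ∃[ i ] ∃[ j ] ∃[ p ] r ≡ entry T ((i , j) , p) × c + i ≡ r + j

------------------------------------------------------------------------
-- Bumpless pipe dreams

data Tile : Set where
  down-elbow up-elbow crossing blank horizontal vertical : Tile

left right top bottom : Tile → Bool

left up-elbow   = true
left crossing   = true
left horizontal = true
left _          = false

right down-elbow = true
right crossing   = true
right horizontal = true
right _          = false

top up-elbow = true
top crossing = true
top vertical = true
top _        = false

bottom down-elbow = true
bottom crossing   = true
bottom vertical   = true
bottom _          = false

-- The outer vector lists the rows from top to bottom.
Tiling : ℕ → Set
Tiling n = Vec (Vec Tile n) n

tile : ∀ {n} → Tiling n → Fin n → Fin n → Tile
tile P i j = lookup (lookup P i) j

record IsBPD {n} (P : Tiling n) : Set where
  field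
    row-match    : ∀ i {j j′} → toℕ j′ ≡ suc (toℕ j) → right (tile P i j) ≡ left (tile P i j′)
    col-match    : ∀ {i i′} j → toℕ i′ ≡ suc (toℕ i) → bottom (tile P i j) ≡ top (tile P i′ j)
    left-border  : ∀ i j → pos j ≡ 1 → left (tile P i j) ≡ false
    right-border : ∀ i j → pos j ≡ n → right (tile P i j) ≡ true
    top-border   : ∀ i j → pos i ≡ 1 → top (tile P i j) ≡ false
    bot-border   : ∀ i j → pos i ≡ n → bottom (tile P i j) ≡ true

blanks : ∀ {n} → Tiling n → Pred Cell 0ℓ
blanks P = cells λ (i , j) → tile P i j ≡ blank

-- Labels on edges; nothing marks an edge not met by a pipe.
Label : ℕ → Set
Label n = Maybe (Fin n)

-- From the labels on the left and bottom edges of a tile to those on its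
-- right and top edges.
propagate : ∀ {n} → Tile → Label n → Label n → Label n × Label n
propagate down-elbow l b = b , nothing
propagate up-elbow   l b = nothing , l
propagate blank      l b = nothing , nothing
propagate horizontal l b = l , nothing
propagate vertical   l b = nothing , b
propagate crossing (just x) (just y) = if does (x ≤? y) then just x , just y else just y , just x
propagate crossing _        _        = nothing , nothing

-- From the labels on the left edge and the bottom edges of a row to those
-- on its right edge and its top edges.
propagateRow : ∀ {n k} → Vec Tile k → Label n → Vec (Label n) k → Label n × Vec (Label n) k
propagateRow []       l []       = l , []
propagateRow (t ∷ ts) l (b ∷ bs) =
  let r , u    = propagate t l b
      out , us = propagateRow ts r bs
  in  out , u ∷ us

-- From the labels on the bottom edges of a stack of rows to those on its
-- right edges and its top edges.
propagateRows : ∀ {n k m} → Vec (Vec Tile k) m → Vec (Label n) k → Vec (Label n) m × Vec (Label n) k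
propagateRows []         bs = [] , bs
propagateRows (ts ∷ tss) bs =
  let outs , us = propagateRows tss bs
      out , us′ = propagateRow ts nothing us
  in  out ∷ outs , us′

∂ : ∀ {n} → Tiling n → Fin n → Label n
∂ P = lookup (proj₁ (propagateRows P (Vec.tabulate just)))

record Pipe {n} (v : Permutation′ n) : Set where
  field
    tiling   : Tiling n
    isBPD    : IsBPD tiling
    demazure : ∀ i → ∂ tiling i ≡ just (v ⟨$⟩ʳ i)

open Pipe public

Pipes : ∀ {n} → Permutation′ n → Setoid 0ℓ 0ℓ
Pipes v = record
  { Carrier       = Pipe v
  ; _≈_           = λ P Q → tiling P ≡ tiling Q
  ; isEquivalence = record { refl = refl ; sym = sym ; trans = trans }
  }

D : ∀ {n} {v : Permutation′ n} → Pipe v → Pred Cell 0ℓ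
D P = blanks (tiling P)

{-# OPTIONS --safe #-}
-- A pipe dream is encoded by its corner heights R(a,b), the number of pipes that
-- enter the northwest a × b rectangle from below: a cell is blank if R does not
-- change along its diagonal and a crossing if R grows by 2.  Write Λ = Y(λ).
--
-- If ∂P = v, then outside Λ the labels, and hence the tiles, are those of the
-- Rothe pipe dream of v: reading rows from the bottom, right to left, the label
-- leaving each row leaves no choice.  Inside Λ there is no crossing: reading rows
-- from the top, the labels stay increasing from left to right, whereas a crossing
-- puts the larger label first.  The second step uses that v is vexillary, in the
-- form that the Rothe pipe dream itself has no crossing inside Λ.  Conversely,
-- without crossings in Λ the labels keep their order there and leave Λ as they do
-- in the Rothe pipe dream, so ∂P = v.
--
-- Height functions without crossings in Λ that are Rothe outside Λ are tableaux in
-- disguise.  The m-th blank on a diagonal corresponds to the m-th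
-- box of μ on it, T(i,j) ≤ a means R(a,a-i+j) + i ≤ a, and the unit
-- step conditions on R turn into semistandardness.  A diagonal carries the right
-- number of blanks because, at its last corner (p,q) in Λ with Rothe height r,
-- there are p - r rows of the diagram with at least q - r boxes and no other row
-- has more than q - r, so that (p-r,q-r) lies on the boundary of Y(μ).
module Submission where

open import Data.Bool using (Bool; true; false; T)
open import Data.Empty using (⊥; ⊥-elim)
open import Data.Fin as Fin using (Fin; toℕ; fromℕ<)
open import Data.Fin.Permutation using (Permutation′; _⟨$⟩ʳ_; _⟨$⟩ˡ_; inverseʳ; inverseˡ)
open import Data.Fin.Properties using (toℕ<n; toℕ-fromℕ<; fromℕ<-toℕ; toℕ-injective)
open import Data.List as List using (List; []; _∷_; length; filter; upTo)
open import Data.List.Extrema.Nat using (argmax-sel)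
open import Data.List.Membership.Propositional.Properties using (∈-filter⁻)
open import Data.List.Relation.Binary.Permutation.Propositional.Properties using (filter-↭; ↭-length)
open import Data.List.Properties using (filter-accept; filter-reject)
open import Data.List.Relation.Unary.Linked using (Linked; []; [-]; _∷_)
import Data.List.Sort as Sort
open import Data.Maybe as Maybe using (Maybe; just; nothing)
open import Data.Maybe.Properties using (just-injective)
open import Data.Nat
open import Data.Nat.Properties
open import Data.Product using (Σ-syntax; ∃-syntax; _×_; _,_; proj₁; proj₂)
open import Data.Sum using (_⊎_; inj₁; inj₂)
open import Data.Unit using (tt)
open import Data.Vec as Vec using (Vec; []; _∷_; lookup)
open import Data.Vec.Properties using (lookup∘tabulate; tabulate-cong; tabulate∘lookup)
open import Function using (_∘_; id; case_of_)
open import Function.Bundles using (Bijection)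
open import Relation.Binary.Bundles using (module Setoid)
import Relation.Binary.Construct.Flip.EqAndOrd as Flip
open import Relation.Binary.Definitions using (tri<; tri≈; tri>)
open import Relation.Binary.PropositionalEquality
open import Relation.Nullary using (¬_; Dec; yes; no; contradiction; ¬?)
open import Relation.Nullary.Decidable using (_×-dec_; _⊎-dec_; map′)
open import Relation.Unary using (Decidable; _≐_; _∈_)
open import Defs

-- Counting

χ : ∀ {P : Set} → Dec P → ℕ
χ (yes _) = 1
χ (no _)  = 0

χ-yes : ∀ {P : Set} (d : Dec P) → P → χ d ≡ 1
χ-yes (yes _) _ = refl
χ-yes (no ¬p) p = contradiction p ¬p

χ-no : ∀ {P : Set} (d : Dec P) → ¬ P → χ d ≡ 0
χ-no (no _)  _  = refl
χ-no (yes p) ¬p = contradiction p ¬p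

χ-mono : ∀ {P Q : Set} (d : Dec P) (e : Dec Q) → (P → Q) → χ d ≤ χ e
χ-mono (no _)  _ _ = z≤n
χ-mono (yes p) e f = ≤-reflexive (sym (χ-yes e (f p)))

χ-cong : ∀ {P Q : Set} (d : Dec P) (e : Dec Q) → (P → Q) → (Q → P) → χ d ≡ χ e
χ-cong d e f g = ≤-antisym (χ-mono d e f) (χ-mono e d g)

χ≤1 : ∀ {P : Set} (d : Dec P) → χ d ≤ 1
χ≤1 (yes _) = ≤-refl
χ≤1 (no _)  = z≤n

module _ {P : ℕ → Set} (P? : Decidable P) where

  count : ℕ → ℕ
  count zero    = 0
  count (suc m) = χ (P? m) + count m

  count-monoʳ : ∀ {m o} → m ≤ o → count m ≤ count o
  count-monoʳ {o = zero}  z≤n = z≤n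
  count-monoʳ {m} {suc o} m≤o with m≤n⇒m<n∨m≡n m≤o
  ... | inj₁ m<o = ≤-trans (count-monoʳ (s≤s⁻¹ m<o)) (m≤n+m _ _)
  ... | inj₂ refl = ≤-refl

  count-bounded : ∀ {m} → (∀ {k} → P k → k < m) → ∀ o → count o ≤ count m
  count-bounded bd zero = z≤n
  count-bounded {m} bd (suc o) with P? o
  ... | no _  = count-bounded bd o
  ... | yes p with count-monoʳ (bd p)
  ...   | le with P? o
  ...     | yes _ = le
  ...     | no ¬p = contradiction p ¬p

module _ {P Q : ℕ → Set} (P? : Decidable P) (Q? : Decidable Q) where

  count-mono : ∀ m → (∀ {k} → k < m → P k → Q k) → count P? m ≤ count Q? m
  count-mono zero    f = z≤n
  count-mono (suc m) f =
    +-mono-≤ (χ-mono (P? m) (Q? m) (f ≤-refl)) (count-mono m (f ∘ m≤n⇒m≤1+n))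

count-¬ : ∀ {P : ℕ → Set} (P? : Decidable P) m → count (¬? ∘ P?) m + count P? m ≡ m
count-¬ P? zero = refl
count-¬ P? (suc m) with P? m
... | yes _ = trans (+-suc _ _) (cong suc (count-¬ P? m))
... | no _  = cong suc (count-¬ P? m)

count-shift : ∀ {P : ℕ → Set} (P? : Decidable P) m →
  count P? (suc m) ≡ χ (P? 0) + count (P? ∘ suc) m
count-shift P? zero    = refl
count-shift P? (suc m) = begin
  χ (P? (suc m)) + count P? (suc m)                   ≡⟨ cong (χ (P? (suc m)) +_) (count-shift P? m) ⟩
  χ (P? (suc m)) + (χ (P? 0) + count (P? ∘ suc) m)    ≡⟨ sym (+-assoc (χ (P? (suc m))) _ _) ⟩
  χ (P? (suc m)) + χ (P? 0) + count (P? ∘ suc) m      ≡⟨ cong (_+ count (P? ∘ suc) m) (+-comm (χ (P? (suc m))) _) ⟩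
  χ (P? 0) + χ (P? (suc m)) + count (P? ∘ suc) m      ≡⟨ +-assoc (χ (P? 0)) _ _ ⟩
  χ (P? 0) + count (P? ∘ suc) (suc m)                 ∎
  where open ≡-Reasoning

length-filter-tabulate : ∀ {A : Set} {P : A → Set} {Q : ℕ → Set} (P? : Decidable P) (Q? : Decidable Q)
  m (f : Fin m → A) → (∀ i → P (f i) → Q (toℕ i)) → (∀ i → Q (toℕ i) → P (f i)) →
  length (filter P? (List.tabulate f)) ≡ count Q? m
length-filter-tabulate P? Q? zero f to from = refl
length-filter-tabulate P? Q? (suc m) f to from
  rewrite count-shift Q? m
  with ih ← length-filter-tabulate P? (Q? ∘ suc) m (f ∘ Fin.suc) (to ∘ Fin.suc) (from ∘ Fin.suc)
  with P? (f Fin.zero)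
... | yes p = cong₂ _+_ (sym (χ-yes (Q? 0) (to Fin.zero p))) ih
... | no ¬p = cong₂ _+_ (sym (χ-no (Q? 0) (¬p ∘ from Fin.zero))) ih

least : ∀ {P : ℕ → Set} → Decidable P → ∀ m → P m → ∃[ x ] P x × (∀ {y} → P y → x ≤ y)
least P? zero    p = 0 , p , λ _ → z≤n
least P? (suc m) p with P? 0
... | yes p₀ = 0 , p₀ , λ _ → z≤n
... | no ¬p₀ with x , px , minimal ← least (P? ∘ suc) m p =
  suc x , px , λ { {zero} p₀ → contradiction p₀ ¬p₀ ; {suc y} py → s≤s (minimal py) }

-- Rows, columns and values count from 0 from here on: b < Λ a says that
-- (a + 1 , b + 1) lies in Y (lam v).  The permutation is extended by the identity
-- to all of ℕ.  The last two fields are what remains of the Rothe diagram and of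
-- pattern avoidance: no box of the diagram lies outside Λ, and the pipes of the
-- Rothe pipe dream do not cross inside Λ.
record Shape (n : ℕ) : Set where
  field
    v u Λ  : ℕ → ℕ
    v∘u    : ∀ b → v (u b) ≡ b
    u∘v    : ∀ a → u (v a) ≡ a
    v<n    : ∀ {a} → a < n → v a < n
    u<n    : ∀ {b} → b < n → u b < n
    Λ-anti : ∀ {a a′} → a ≤ a′ → Λ a′ ≤ Λ a
    Λ≤n    : ∀ a → Λ a ≤ n
    Λ-n    : Λ n ≡ 0
    outside   : ∀ {a b} → Λ a ≤ b → b < v a → u b ≤ a
    vexillary : ∀ {k a} → k < a → v k < Λ a → v k < v a

-- The rank function of the permutation matrix.

module Rank {n} (S : Shape n) where
  open Shape S

  -- The dots `(k , v k)` northwest of the corner. This is the height of the Rothe pipe dream there,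
  -- whose pipes are hooks with elbows at the dots.
  r : ℕ → ℕ → ℕ
  r a b = count (λ k → v k <? b) a

  r-suc-< : ∀ {a b} → v a < b → r (suc a) b ≡ suc (r a b)
  r-suc-< {a} {b} lt = cong (_+ r a b) (χ-yes (v a <? b) lt)

  r-suc-≥ : ∀ {a b} → b ≤ v a → r (suc a) b ≡ r a b
  r-suc-≥ {a} {b} le = cong (_+ r a b) (χ-no (v a <? b) (≤⇒≯ le))

  -- The mixed difference of `r` is the indicator of the dot, whether written `v a ≡ b` or
  -- `u b ≡ a`; the terms are placed so that no subtraction occurs.
  χ-col : ∀ a b → χ (v a <? suc b) + χ (u b <? a) ≡ χ (u b <? suc a) + χ (v a <? b)
  χ-col a b with <-cmp (v a) b
  ... | tri< va<b va≢b _ = begin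
    χ (v a <? suc b) + χ (u b <? a) ≡⟨ cong (_+ χ (u b <? a)) (trans (χ-yes (v a <? suc b) (m≤n⇒m≤1+n va<b)) (sym (χ-yes (v a <? b) va<b))) ⟩
    χ (v a <? b) + χ (u b <? a)     ≡⟨ +-comm (χ (v a <? b)) _ ⟩
    χ (u b <? a) + χ (v a <? b)     ≡⟨ cong (_+ χ (v a <? b)) (χ-cong (u b <? a) (u b <? suc a) m≤n⇒m≤1+n (λ le → ≤∧≢⇒< (s≤s⁻¹ le) λ e → va≢b (trans (cong v (sym e)) (v∘u b)))) ⟩
    χ (u b <? suc a) + χ (v a <? b) ∎
    where open ≡-Reasoning
  ... | tri≈ _ refl _
    rewrite u∘v a | χ-yes (v a <? suc (v a)) ≤-refl | χ-no (a <? a) (<-irrefl refl)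
          | χ-yes (a <? suc a) ≤-refl | χ-no (v a <? v a) (<-irrefl refl) = refl
  ... | tri> va≮b va≢b b<va
    rewrite χ-no (v a <? suc b) (<⇒≱ b<va ∘ s≤s⁻¹) | χ-no (v a <? b) va≮b
    = trans (χ-cong (u b <? a) (u b <? suc a) m≤n⇒m≤1+n (λ le → ≤∧≢⇒< (s≤s⁻¹ le) λ e → va≢b (trans (cong v (sym e)) (v∘u b)))) (sym (+-identityʳ _))

  r-col : ∀ a b → r a (suc b) ≡ χ (u b <? a) + r a b
  r-col zero    b = refl
  r-col (suc a) b = begin
    χ (v a <? suc b) + r a (suc b)              ≡⟨ cong (χ (v a <? suc b) +_) (r-col a b) ⟩
    χ (v a <? suc b) + (χ (u b <? a) + r a b)   ≡⟨ sym (+-assoc (χ (v a <? suc b)) _ _) ⟩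
    χ (v a <? suc b) + χ (u b <? a) + r a b     ≡⟨ cong (_+ r a b) (χ-col a b) ⟩
    χ (u b <? suc a) + χ (v a <? b) + r a b     ≡⟨ +-assoc (χ (u b <? suc a)) _ _ ⟩
    χ (u b <? suc a) + (χ (v a <? b) + r a b)   ∎
    where open ≡-Reasoning

  Λ-row : ∀ {a b} → b < Λ a → a < n
  Λ-row b<Λ = ≰⇒> λ n≤a → contradiction (<-≤-trans b<Λ (≤-trans (Λ-anti n≤a) (≤-reflexive Λ-n))) λ ()

  r-zeroʳ : ∀ a → r a 0 ≡ 0
  r-zeroʳ zero    = refl
  r-zeroʳ (suc a) = r-zeroʳ a

  r-by-columns : ∀ a b → r a b ≡ count (λ j → u j <? a) b
  r-by-columns a zero    = r-zeroʳ a
  r-by-columns a (suc b) = trans (r-col a b) (cong (χ (u b <? a) +_) (r-by-columns a b))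

  r-col-< : ∀ {a b} → u b < a → r a (suc b) ≡ suc (r a b)
  r-col-< {a} {b} lt = trans (r-col a b) (cong (_+ r a b) (χ-yes (u b <? a) lt))

  r-col-≥ : ∀ {a b} → a ≤ u b → r a (suc b) ≡ r a b
  r-col-≥ {a} {b} le = trans (r-col a b) (cong (_+ r a b) (χ-no (u b <? a) (≤⇒≯ le)))

  r-monoʳ : ∀ a {b c} → b ≤ c → r a b ≤ r a c
  r-monoʳ a {b} {c} b≤c = count-mono (λ k → v k <? b) (λ k → v k <? c) a λ _ lt → <-≤-trans lt b≤c

  r≤b : ∀ a b → r a b ≤ b
  r≤b a b = begin
    r a b                        ≡⟨ r-by-columns a b ⟩
    count _ b                    ≤⟨ m≤n+m _ _ ⟩
    _ + count (λ j → u j <? a) b ≡⟨ count-¬ (λ j → u j <? a) b ⟩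
    b                            ∎
    where open ≤-Reasoning

  r≤a : ∀ a b → r a b ≤ a
  r≤a a b = ≤-trans (m≤n+m _ _) (≤-reflexive (count-¬ (λ k → v k <? b) a))

  r-rightmost : ∀ {a} → a ≤ n → r a n ≡ a
  r-rightmost {zero}  _   = refl
  r-rightmost {suc a} a<n = trans (r-suc-< (v<n a<n)) (cong suc (r-rightmost (<⇒≤ a<n)))

  r-bottom : ∀ {b} → b ≤ n → r n b ≡ b
  r-bottom {zero}  _   = r-zeroʳ n
  r-bottom {suc b} b<n = trans (r-col-< (u<n b<n)) (cong suc (r-bottom (<⇒≤ b<n)))

  r-col-inv : ∀ {a b} → r a (suc b) ≡ suc (r a b) → u b < a
  r-col-inv {a} {b} e with <-≤-connex (u b) a
  ... | inj₁ lt = lt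
  ... | inj₂ ge = contradiction (trans (sym e) (r-col-≥ ge)) 1+n≢n

  -- No earlier dot lies in the columns from `v a` up to `Λ a`: by `vexillary`, an earlier value
  -- below `Λ a` is below `v a`.
  r-at-dot : ∀ {a} → v a < Λ a → r a (v a) ≡ r a (Λ a)
  r-at-dot {a} va<Λ = ≤-antisym (r-monoʳ a (<⇒≤ va<Λ))
    (count-mono (λ k → v k <? Λ a) (λ k → v k <? v a) a λ k<a vk<Λ → vexillary k<a vk<Λ)

  r-past-dot : ∀ {a} → v a < Λ a → r (suc a) (suc (v a)) ≡ r (suc a) (Λ a)
  r-past-dot {a} va<Λ = begin
    r (suc a) (suc (v a))   ≡⟨ r-suc-< ≤-refl ⟩
    suc (r a (suc (v a)))   ≡⟨ cong suc (r-col-≥ (≤-reflexive (sym (u∘v a)))) ⟩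
    suc (r a (v a))         ≡⟨ cong suc (r-at-dot va<Λ) ⟩
    suc (r a (Λ a))         ≡⟨ sym (r-suc-< va<Λ) ⟩
    r (suc a) (Λ a)         ∎
    where open ≡-Reasoning

-- Row sizes of the diagram and the sorted code

module Frontier {n} (S : Shape n) where
  open Shape S
  open Rank S

  inRow? : ∀ a → Decidable (λ j → j < v a × a < u j)
  inRow? a j = (j <? v a) ×-dec (a <? u j)

  rowSize : ℕ → ℕ
  rowSize a = count (inRow? a) n

  rowSize≥? : ∀ y → Decidable (λ a → y ≤ rowSize a)
  rowSize≥? y a = y ≤? rowSize a

  Inside : ℕ → ℕ → Set
  Inside P Q = ∀ {a b} → a < P → b < Q → b < Λ a

  module _ {P Q : ℕ} where

    private
      q = r P Q

    columns-free : count (λ j → ¬? (u j <? P)) Q ≡ Q ∸ q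
    columns-free = begin
      count (λ j → ¬? (u j <? P)) Q           ≡⟨ sym (m+n∸n≡m _ q) ⟩
      count (λ j → ¬? (u j <? P)) Q + q ∸ q   ≡⟨ cong (λ z → count (λ j → ¬? (u j <? P)) Q + z ∸ q) (r-by-columns P Q) ⟩
      _                                       ≡⟨ cong (_∸ q) (count-¬ (λ j → u j <? P) Q) ⟩
      Q ∸ q                                   ∎
      where open ≡-Reasoning

    rows-free : count (λ k → ¬? (v k <? Q)) P ≡ P ∸ q
    rows-free = trans (sym (m+n∸n≡m _ q)) (cong (_∸ q) (count-¬ (λ k → v k <? Q) P))

    -- A column before `Q` whose dot is not above row `P` gives a box in row `a`, because the dot of
    -- row `a` is further right and higher up.
    rowSize-≥ : ∀ {a} → a < n → a < P → Q ≤ v a → Q ∸ q ≤ rowSize a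
    rowSize-≥ {a} a<n a<P Q≤va = begin
      Q ∸ q                           ≡⟨ sym columns-free ⟩
      count (λ j → ¬? (u j <? P)) Q   ≤⟨ count-mono _ (inRow? a) Q (λ j<Q uj≮P → <-≤-trans j<Q Q≤va , <-≤-trans a<P (≮⇒≥ uj≮P)) ⟩
      count (inRow? a) Q              ≤⟨ count-monoʳ (inRow? a) (≤-trans Q≤va (<⇒≤ (v<n a<n))) ⟩
      rowSize a                       ∎
      where open ≤-Reasoning

    frontier-≥ : P ≤ n → P ∸ q ≤ count (rowSize≥? (Q ∸ q)) n
    frontier-≥ P≤n = begin
      P ∸ q                           ≡⟨ sym rows-free ⟩
      count (λ k → ¬? (v k <? Q)) P   ≤⟨ count-mono _ (rowSize≥? _) P (λ k<P vk≮Q → rowSize-≥ (<-≤-trans k<P P≤n) k<P (≮⇒≥ vk≮Q)) ⟩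
      count (rowSize≥? (Q ∸ q)) P     ≤⟨ count-monoʳ (rowSize≥? _) P≤n ⟩
      count (rowSize≥? (Q ∸ q)) n     ∎
      where open ≤-Reasoning

    module _ (Λ≤Q : Λ P ≤ Q) (inside : Inside P Q) where

      -- Below row P this holds because the diagram does not leave Λ, above it
      -- because the Rothe pipes do not cross inside Λ.
      rowSize-≤ : ∀ {a} → ¬ (a < P × Q ≤ v a) → rowSize a ≤ Q ∸ q
      rowSize-≤ {a} off = begin
        rowSize a
          ≤⟨ count-mono (inRow? a) both? n (λ _ h → box-column h , h) ⟩
        count both? n
          ≤⟨ count-bounded both? proj₁ n ⟩
        count both? Q
          ≤⟨ count-mono both? _ Q (λ _ h → box-below h) ⟩
        count (λ j → ¬? (u j <? P)) Q
          ≡⟨ columns-free ⟩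
        Q ∸ q ∎
        where
        open ≤-Reasoning
        -- The bound `j < Q` is recorded so that `count-bounded` can change the range from `n` to
        -- `Q`.
        both? : Decidable (λ j → j < Q × j < v a × a < u j)
        both? j = (j <? Q) ×-dec inRow? a j

        box-column : ∀ {j} → j < v a × a < u j → j < Q
        box-column {j} (j<va , a<uj) with <-≤-connex a P
        ... | inj₁ a<P = <-trans j<va (≰⇒> λ Q≤va → off (a<P , Q≤va))
        ... | inj₂ P≤a with <-≤-connex j Q
        ...   | inj₁ j<Q = j<Q
        ...   | inj₂ Q≤j = contradiction (outside (≤-trans (Λ-anti P≤a) (≤-trans Λ≤Q Q≤j)) j<va) (<⇒≱ a<uj)

        box-below : ∀ {j} → j < Q × j < v a × a < u j → ¬ (u j < P)
        box-below {j} (_ , j<va , a<uj) uj<P with <-≤-connex (v a) Q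
        ... | inj₂ Q≤va = off (<-trans a<uj uj<P , Q≤va)
        ... | inj₁ va<Q = <-asym j<va (subst (v a <_) (v∘u j) (vexillary a<uj (inside uj<P va<Q)))

      -- By `rowSize-≤` such a row is above `P` with its dot in column `Q` or later, and there are
      -- `P ∸ q` of those. With `frontier-≥` this puts `(P ∸ q , Q ∸ q)` on the boundary of the
      -- sorted code.
      frontier-≤ : count (rowSize≥? (suc (Q ∸ q))) n ≤ P ∸ q
      frontier-≤ = begin
        count (rowSize≥? (suc (Q ∸ q))) n
          ≤⟨ count-mono _ above? n (λ _ big → big⇒above big) ⟩
        count above? n
          ≤⟨ count-bounded above? proj₁ n ⟩
        count above? P
          ≤⟨ count-mono above? _ P (λ _ (_ , Q≤vk) → ≤⇒≯ Q≤vk) ⟩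
        count (λ k → ¬? (v k <? Q)) P
          ≡⟨ rows-free ⟩
        P ∸ q ∎
        where
        open ≤-Reasoning
        above? : Decidable (λ k → k < P × Q ≤ v k)
        above? k = (k <? P) ×-dec (Q ≤? v k)

        big⇒above : ∀ {a} → suc (Q ∸ q) ≤ rowSize a → a < P × Q ≤ v a
        big⇒above {a} big with above? a
        ... | yes h = h
        ... | no ¬h = contradiction (rowSize-≤ ¬h) (<⇒≱ big)

-- Parts of a weakly decreasing list.

atLeast : ℕ → List ℕ → ℕ
atLeast y xs = length (filter (y ≤?_) xs)

atLeast-accept : ∀ {y x} xs → y ≤ x → atLeast y (x ∷ xs) ≡ suc (atLeast y xs)
atLeast-accept {y} xs y≤x = cong length (filter-accept (y ≤?_) {xs = xs} y≤x)

atLeast-reject : ∀ {y x} xs → x < y → atLeast y (x ∷ xs) ≡ atLeast y xs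
atLeast-reject {y} xs x<y = cong length (filter-reject (y ≤?_) {xs = xs} (<⇒≱ x<y))

linked-tail : ∀ {x xs} → Linked _≥_ (x ∷ xs) → Linked _≥_ xs
linked-tail [-]     = []
linked-tail (_ ∷ l) = l

atLeast-low : ∀ {y x xs} → x < y → Linked _≥_ (x ∷ xs) → atLeast y (x ∷ xs) ≡ 0
atLeast-low {xs = xs} x<y l = trans (atLeast-reject xs x<y) (rest l)
  where
  rest : ∀ {xs} → Linked _≥_ (_ ∷ xs) → atLeast _ xs ≡ 0
  rest [-]       = refl
  rest (x≥z ∷ l) = atLeast-low (≤-<-trans x≥z x<y) l

-- In a weakly decreasing list the entries that are at least `y` come first.
parts-≥ : ∀ {y} xs i → Linked _≥_ xs → suc i ≤ atLeast y xs → y ≤ parts xs (suc i)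
parts-≥ {y} (x ∷ xs) i l le with <-≤-connex x y
... | inj₁ x<y = contradiction (subst (suc i ≤_) (atLeast-low x<y l) le) λ ()
parts-≥ {y} (x ∷ xs) zero    l le | inj₂ y≤x = y≤x
parts-≥ {y} (x ∷ xs) (suc i) l le | inj₂ y≤x =
  parts-≥ xs i (linked-tail l) (s≤s⁻¹ (subst (suc (suc i) ≤_) (atLeast-accept xs y≤x) le))

parts-≤-head : ∀ {x} xs i → Linked _≥_ (x ∷ xs) → parts xs i ≤ x
parts-≤-head []       i             l         = z≤n
parts-≤-head (z ∷ zs) zero          l         = z≤n
parts-≤-head (z ∷ zs) (suc zero)    (x≥z ∷ l) = x≥z
parts-≤-head (z ∷ zs) (suc (suc i)) (x≥z ∷ l) = ≤-trans (parts-≤-head zs (suc i) l) x≥z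

parts-≤ : ∀ {y} xs i → Linked _≥_ xs → atLeast (suc y) xs ≤ i → parts xs (suc i) ≤ y
parts-≤ [] i l le = z≤n
parts-≤ {y} (x ∷ xs) i l le with <-≤-connex y x
parts-≤ {y} (x ∷ xs) zero    l le | inj₁ y<x =
  contradiction (subst (_≤ 0) (atLeast-accept xs y<x) le) λ ()
parts-≤ {y} (x ∷ xs) (suc i) l le | inj₁ y<x =
  parts-≤ xs i (linked-tail l) (s≤s⁻¹ (subst (_≤ suc i) (atLeast-accept xs y<x) le))
parts-≤ {y} (x ∷ xs) zero    l le | inj₂ x≤y = x≤y
parts-≤ {y} (x ∷ xs) (suc i) l le | inj₂ x≤y = ≤-trans (parts-≤-head xs (suc i) l) x≤y

parts-suc-≤ : ∀ xs i → Linked _≥_ xs → parts xs (suc (suc i)) ≤ parts xs (suc i)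
parts-suc-≤ []       i       l = z≤n
parts-suc-≤ (x ∷ xs) zero    l = parts-≤-head xs 1 l
parts-suc-≤ (x ∷ xs) (suc i) l = parts-suc-≤ xs i (linked-tail l)

parts-anti : ∀ xs {i j} → Linked _≥_ xs → i ≤ j → parts xs (suc j) ≤ parts xs (suc i)
parts-anti xs {i} {zero}  l z≤n = ≤-refl
parts-anti xs {i} {suc j} l i≤j with m≤n⇒m<n∨m≡n i≤j
... | inj₁ i<j  = ≤-trans (parts-suc-≤ xs j l) (parts-anti xs l (s≤s⁻¹ i<j))
... | inj₂ refl = ≤-refl

-- Labellings of bumpless pipe dreams

onFin : ∀ {n} {Q : ℕ → Set} → (∀ (i : Fin n) → Q (toℕ i)) → ∀ {a} → a < n → Q a
onFin {Q = Q} f a<n = subst Q (toℕ-fromℕ< a<n) (f (fromℕ< a<n))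

at : ∀ {A : Set} {k} → A → Vec A k → ℕ → A
at d []       _       = d
at d (x ∷ xs) zero    = x
at d (x ∷ xs) (suc m) = at d xs m

lookup≡at : ∀ {A : Set} {k} (d : A) (xs : Vec A k) i → lookup xs i ≡ at d xs (toℕ i)
lookup≡at d (x ∷ xs) Fin.zero    = refl
lookup≡at d (x ∷ xs) (Fin.suc i) = lookup≡at d xs i

-- Indexing by naturals, with blanks outside the grid, makes `a` and `suc a` neighbours without
-- `Fin` arithmetic.
tileAt : ∀ {n} → Tiling n → ℕ → ℕ → Tile
tileAt {n} P a b = at blank (at (Vec.replicate n blank) P a) b

tile≡tileAt : ∀ {n} (P : Tiling n) i j → tile P i j ≡ tileAt P (toℕ i) (toℕ j)
tile≡tileAt {n} P i j = trans (lookup≡at blank (lookup P i) j)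
  (cong (λ row → at blank row (toℕ j)) (lookup≡at (Vec.replicate n blank) P i))

tilingOf : ∀ n → (ℕ → ℕ → Tile) → Tiling n
tilingOf n τ = Vec.tabulate λ i → Vec.tabulate λ j → τ (toℕ i) (toℕ j)

tile-tilingOf : ∀ {n} τ (i j : Fin n) → tile (tilingOf n τ) i j ≡ τ (toℕ i) (toℕ j)
tile-tilingOf τ i j = trans (cong (λ row → lookup row j) (lookup∘tabulate _ i)) (lookup∘tabulate _ j)

tiling-ext : ∀ {n} (P Q : Tiling n) → (∀ {a b} → a < n → b < n → tileAt P a b ≡ tileAt Q a b) → P ≡ Q
tiling-ext P Q e = begin
  P                                                        ≡⟨ sym (tabulate₂ P) ⟩
  Vec.tabulate (λ i → Vec.tabulate (λ j → tile P i j))     ≡⟨ tabulate-cong (λ i → tabulate-cong (λ j → tiles i j)) ⟩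
  Vec.tabulate (λ i → Vec.tabulate (λ j → tile Q i j))     ≡⟨ tabulate₂ Q ⟩
  Q                                                        ∎
  where
  open ≡-Reasoning
  tabulate₂ : ∀ P → Vec.tabulate (λ i → Vec.tabulate (λ j → tile P i j)) ≡ P
  tabulate₂ P = trans (tabulate-cong (λ i → tabulate∘lookup (lookup P i))) (tabulate∘lookup P)
  tiles : ∀ i j → tile P i j ≡ tile Q i j
  tiles i j = trans (tile≡tileAt P i j) (trans (e (toℕ<n i) (toℕ<n j)) (sym (tile≡tileAt Q i j)))

-- The graph of `propagate` on inputs whose labels sit exactly on the edges that the tile uses; the
-- fallback cases of `propagate` have no constructor.
data Step : Tile → (l b r u : Maybe ℕ) → Set where
  down-elbow : ∀ {y} → Step down-elbow nothing (just y) (just y) nothing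
  up-elbow   : ∀ {x} → Step up-elbow (just x) nothing nothing (just x)
  blank      : Step blank nothing nothing nothing nothing
  horizontal : ∀ {x} → Step horizontal (just x) nothing (just x) nothing
  vertical   : ∀ {y} → Step vertical nothing (just y) nothing (just y)
  crossing   : ∀ {x y} → Step crossing (just x) (just y) (just (x ⊓ y)) (just (x ⊔ y))

is-just : ∀ {A : Set} → Maybe A → Bool
is-just (just _) = true
is-just nothing  = false

module _ {t : Tile} {l b r u : Maybe ℕ} where

  step-right : Step t l b r u → is-just r ≡ right t
  step-right down-elbow = refl
  step-right up-elbow   = refl
  step-right blank      = refl
  step-right horizontal = refl
  step-right vertical   = refl
  step-right crossing   = refl

  step-top : Step t l b r u → is-just u ≡ top t
  step-top down-elbow = refl
  step-top up-elbow   = refl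
  step-top blank      = refl
  step-top horizontal = refl
  step-top vertical   = refl
  step-top crossing   = refl

labelℕ : ∀ {n} → Label n → Maybe ℕ
labelℕ = Maybe.map toℕ

propagate-step : ∀ {n} t (l b : Label n) → is-just (labelℕ l) ≡ left t → is-just (labelℕ b) ≡ bottom t →
  Step t (labelℕ l) (labelℕ b) (labelℕ (proj₁ (propagate t l b))) (labelℕ (proj₂ (propagate t l b)))
propagate-step down-elbow nothing  (just _) _ _ = down-elbow
propagate-step up-elbow   (just _) nothing  _ _ = up-elbow
propagate-step blank      nothing  nothing  _ _ = blank
propagate-step horizontal (just _) nothing  _ _ = horizontal
propagate-step vertical   nothing  (just _) _ _ = vertical
propagate-step crossing   (just x) (just y) _ _ with toℕ x ≤ᵇ toℕ y in eq
... | true  = subst₂ (λ m M → Step crossing _ _ (just m) (just M)) (m≤n⇒m⊓n≡m x≤y) (m≤n⇒m⊔n≡n x≤y) crossing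
  where
  x≤y : toℕ x ≤ toℕ y
  x≤y = ≤ᵇ⇒≤ _ _ (subst T (sym eq) tt)
... | false = subst₂ (λ m M → Step crossing _ _ (just m) (just M)) (m≥n⇒m⊓n≡n y≤x) (m≥n⇒m⊔n≡m y≤x) crossing
  where
  y≤x : toℕ y ≤ toℕ x
  y≤x = ≰⇒≥ λ x≤y → subst T eq (≤⇒≤ᵇ x≤y)

-- `propagateRow` forgets the labels between neighbouring cells; `h` keeps them.
row-labels : ∀ {n k} (ts : Vec Tile k) (l : Label n) bs →
  Σ[ h ∈ (ℕ → Label n) ] h 0 ≡ l × h k ≡ proj₁ (propagateRow ts l bs) ×
    (∀ j → propagate (lookup ts j) (h (toℕ j)) (lookup bs j) ≡
           (h (suc (toℕ j)) , lookup (proj₂ (propagateRow ts l bs)) j))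
row-labels [] l [] = (λ _ → l) , refl , refl , λ ()
row-labels (t ∷ ts) l (b ∷ bs)
  with h , h-start , h-end , h-steps ← row-labels ts (proj₁ (propagate t l b)) bs =
  (λ { zero → l ; (suc m) → h m }) , refl , h-end ,
  λ { Fin.zero → cong (_, proj₂ (propagate t l b)) (sym h-start) ; (Fin.suc j) → h-steps j }

rows-labels : ∀ {n k m} (tss : Vec (Vec Tile k) m) (bs : Vec (Label n) k) →
  Σ[ h ∈ (ℕ → ℕ → Label n) ] Σ[ w ∈ (ℕ → Vec (Label n) k) ] w m ≡ bs × w 0 ≡ proj₂ (propagateRows tss bs) ×
    (∀ (i : Fin m) → h (toℕ i) 0 ≡ nothing) × (∀ i → h (toℕ i) k ≡ lookup (proj₁ (propagateRows tss bs)) i) ×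
    (∀ i j → propagate (lookup (lookup tss i) j) (h (toℕ i) (toℕ j)) (lookup (w (suc (toℕ i))) j) ≡
             (h (toℕ i) (suc (toℕ j)) , lookup (w (toℕ i)) j))
rows-labels [] bs = (λ _ _ → nothing) , (λ _ → bs) , refl , refl , (λ ()) , (λ ()) , λ ()
rows-labels (ts ∷ tss) bs
  with h , w , w-bot , w-top , h-start , h-end , steps ← rows-labels tss bs
  with h₀ , h₀-start , h₀-end , h₀-steps ← row-labels ts nothing (proj₂ (propagateRows tss bs)) =
  (λ { zero → h₀ ; (suc a) → h a }) ,
  (λ { zero → proj₂ (propagateRow ts nothing (proj₂ (propagateRows tss bs))) ; (suc a) → w a }) ,
  w-bot , refl ,
  (λ { Fin.zero → h₀-start ; (Fin.suc i) → h-start i }) ,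
  (λ { Fin.zero → h₀-end ; (Fin.suc i) → h-end i }) ,
  λ { Fin.zero j → trans (cong (λ bs → propagate (lookup ts j) (h₀ (toℕ j)) (lookup bs j)) w-top) (h₀-steps j)
    ; (Fin.suc i) j → steps i j }

-- `h a b` is the label on the left edge of the cell `(a , b)` and `w a b` the one on its top edge,
-- so `h a (suc b)` and `w (suc a) b` belong to its right and bottom edges.
record Labelling {n} (P : Tiling n) : Set where
  field
    h w     : ℕ → ℕ → Maybe ℕ
    h-start : ∀ {a} → a < n → h a 0 ≡ nothing
    w-bot   : ∀ {b} → b < n → w n b ≡ just b
    step    : ∀ {a b} → a < n → b < n → Step (tileAt P a b) (h a b) (w (suc a) b) (h a (suc b)) (w a b)
    h-end   : ∀ i → h (toℕ i) n ≡ labelℕ (∂ P i)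

module _ {n} {P : Tiling n} (bpd : IsBPD P) where
  open IsBPD bpd

  private
    on₂ : ∀ {Q : ℕ → ℕ → Set} → (∀ (i j : Fin n) → Q (toℕ i) (toℕ j)) → ∀ {a b} → a < n → b < n → Q a b
    on₂ {Q} f {a} {b} a<n b<n =
      onFin {Q = λ a → Q a b} (λ i → onFin {Q = Q (toℕ i)} (f i) b<n) a<n

    τ : ℕ → ℕ → Tile
    τ = tileAt P

    fin : ∀ {a b} (a<n : a < n) (b<n : b < n) → τ a b ≡ tile P (fromℕ< a<n) (fromℕ< b<n)
    fin a<n b<n = trans (sym (cong₂ τ (toℕ-fromℕ< a<n) (toℕ-fromℕ< b<n))) (sym (tile≡tileAt P _ _))

  row-matchℕ : ∀ {a b} → a < n → suc b < n → right (τ a b) ≡ left (τ a (suc b))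
  row-matchℕ a<n sb<n = begin
    right (τ _ _) ≡⟨ cong right (fin a<n (<⇒≤ sb<n)) ⟩
    _             ≡⟨ row-match _ (trans (toℕ-fromℕ< sb<n) (cong suc (sym (toℕ-fromℕ< (<⇒≤ sb<n))))) ⟩
    _             ≡⟨ cong left (sym (fin a<n sb<n)) ⟩
    left (τ _ _)  ∎
    where open ≡-Reasoning

  col-matchℕ : ∀ {a b} → suc a < n → b < n → bottom (τ a b) ≡ top (τ (suc a) b)
  col-matchℕ sa<n b<n = begin
    bottom (τ _ _) ≡⟨ cong bottom (fin (<⇒≤ sa<n) b<n) ⟩
    _              ≡⟨ col-match _ (trans (toℕ-fromℕ< sa<n) (cong suc (sym (toℕ-fromℕ< (<⇒≤ sa<n))))) ⟩
    _              ≡⟨ cong top (sym (fin sa<n b<n)) ⟩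
    top (τ _ _)    ∎
    where open ≡-Reasoning

  left-borderℕ : ∀ {a} → a < n → left (τ a 0) ≡ false
  left-borderℕ a<n = trans (cong left (fin a<n (m<n⇒0<n a<n)))
    (left-border _ _ (cong suc (toℕ-fromℕ< (m<n⇒0<n a<n))))

  top-borderℕ : ∀ {b} → b < n → top (τ 0 b) ≡ false
  top-borderℕ b<n = trans (cong top (fin (m<n⇒0<n b<n) b<n))
    (top-border _ _ (cong suc (toℕ-fromℕ< (m<n⇒0<n b<n))))

  bot-borderℕ : ∀ {a b} → suc a ≡ n → b < n → bottom (τ a b) ≡ true
  bot-borderℕ sa≡n b<n = trans (cong bottom (fin (≤-reflexive sa≡n) b<n))
    (bot-border _ _ (trans (cong suc (toℕ-fromℕ< (≤-reflexive sa≡n))) sa≡n))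

  labelling : Labelling P
  labelling
    with h₀ , w₀ , w₀-bot , w₀-top , h₀-start , h₀-end , steps ← rows-labels P (Vec.tabulate just) = record
    { h       = h
    ; w       = w
    ; h-start = λ a<n → cong labelℕ (h₀-start′ a<n)
    ; w-bot   = λ b<n → w-botℕ b<n
    ; step    = λ {a} {b} a<n b<n → proj₁ (row a<n (below a<n) b<n)
    ; h-end   = λ i → cong labelℕ (h₀-end i)
    }
    where
    h w : ℕ → ℕ → Maybe ℕ
    h a b = labelℕ (h₀ a b)
    w a b = labelℕ (at nothing (w₀ a) b)

    h₀-start′ : ∀ {a} → a < n → h₀ a 0 ≡ nothing
    h₀-start′ = onFin {Q = λ a → h₀ a 0 ≡ nothing} h₀-start

    w-botℕ : ∀ {b} → b < n → w n b ≡ just b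
    w-botℕ = onFin {Q = λ b → w n b ≡ just b} λ j → cong labelℕ
      (trans (sym (lookup≡at nothing (w₀ n) j)) (trans (cong (λ bs → lookup bs j) w₀-bot) (lookup∘tabulate just j)))

    steps′ : ∀ {a b} → a < n → b < n →
      propagate (τ a b) (h₀ a b) (at nothing (w₀ (suc a)) b) ≡ (h₀ a (suc b) , at nothing (w₀ a) b)
    steps′ = on₂ {Q = λ a b → propagate (τ a b) (h₀ a b) (at nothing (w₀ (suc a)) b) ≡ (h₀ a (suc b) , at nothing (w₀ a) b)}
      λ i j → subst₂ (λ t bl → propagate t (h₀ (toℕ i) (toℕ j)) bl ≡ (h₀ (toℕ i) (suc (toℕ j)) , at nothing (w₀ (toℕ i)) (toℕ j)))
        (tile≡tileAt P i j) (lookup≡at nothing (w₀ (suc (toℕ i))) j)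
        (trans (steps i j) (cong (h₀ (toℕ i) (suc (toℕ j)) ,_) (lookup≡at nothing (w₀ (toℕ i)) j)))

    Bottoms : ℕ → Set
    Bottoms a = ∀ {b} → b < n → is-just (w (suc a) b) ≡ bottom (τ a b)

    one : ∀ {a b} → a < n → b < n → is-just (h a b) ≡ left (τ a b) → is-just (w (suc a) b) ≡ bottom (τ a b) →
      Step (τ a b) (h a b) (w (suc a) b) (h a (suc b)) (w a b)
    one {a} {b} a<n b<n l≡ b≡ = subst₂ (λ r u → Step (τ a b) (h a b) (w (suc a) b) (labelℕ r) (labelℕ u))
      (cong proj₁ (steps′ a<n b<n)) (cong proj₂ (steps′ a<n b<n)) (propagate-step (τ a b) (h₀ a b) _ l≡ b≡)

    -- Labels are matched with the edges of the tiles in the direction of propagation: from the left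
    -- border in each row, and by `below′` from the bottom row upwards.
    row : ∀ {a b} → a < n → Bottoms a → b < n →
      Step (τ a b) (h a b) (w (suc a) b) (h a (suc b)) (w a b) × is-just (h a b) ≡ left (τ a b)
    row {b = zero} a<n bots b<n =
      let l≡ = trans (cong is-just (cong labelℕ (h₀-start′ a<n))) (sym (left-borderℕ a<n))
      in one a<n b<n l≡ (bots b<n) , l≡
    row {b = suc b} a<n bots b<n =
      let s , _ = row a<n bots (<⇒≤ b<n)
          l≡ = trans (step-right s) (row-matchℕ a<n b<n)
      in one a<n b<n l≡ (bots b<n) , l≡

    below′ : ∀ d {a} → suc a + d ≡ n → Bottoms a
    below′ zero e b<n = trans (cong is-just (trans (cong (λ m → w m _) (trans (sym (+-identityʳ _)) e)) (w-botℕ b<n)))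
      (sym (bot-borderℕ (trans (sym (+-identityʳ _)) e) b<n))
    below′ (suc d) {a} e b<n =
      let e′ = trans (sym (+-suc (suc a) d)) e
          sa<n = m+n≤o⇒m≤o (suc (suc a)) (≤-reflexive e′)
      in trans (step-top (proj₁ (row sa<n (below′ d e′) b<n))) (sym (col-matchℕ sa<n b<n))

    below : ∀ {a} → a < n → Bottoms a
    below {a} a<n = below′ (n ∸ suc a) (m+[n∸m]≡n a<n)

-- Corner heights; the profile of a pipe dream

downward : ∀ {n} (Q : ℕ → Set) → Q n → (∀ {a} → a < n → Q (suc a) → Q a) → ∀ {a} → a ≤ n → Q a
downward {n} Q qn down {a} a≤n = go (n ∸ a) (m+[n∸m]≡n a≤n)
  where
  go : ∀ d {a} → a + d ≡ n → Q a
  go zero    e = subst Q (trans (sym e) (+-identityʳ _)) qn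
  go (suc d) e = let e′ = trans (sym (+-suc _ d)) e in
    down (m+n≤o⇒m≤o _ (≤-reflexive e′)) (go d e′)

upward : ∀ {n} (Q : ℕ → Set) → Q 0 → (∀ {a} → a < n → Q a → Q (suc a)) → ∀ {a} → a ≤ n → Q a
upward Q q0 up {zero}  _   = q0
upward Q q0 up {suc a} a<n = up a<n (upward Q q0 up (<⇒≤ a<n))

⟦_⟧ : Bool → ℕ
⟦ true ⟧  = 1
⟦ false ⟧ = 0

⟦⟧-injective : ∀ {x y} → ⟦ x ⟧ ≡ ⟦ y ⟧ → x ≡ y
⟦⟧-injective {true}  {true}  _ = refl
⟦⟧-injective {false} {false} _ = refl

⟦⟧-cancel : ∀ {x y k m} → k ≡ ⟦ x ⟧ + m → k ≡ ⟦ y ⟧ + m → x ≡ y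
⟦⟧-cancel e f = ⟦⟧-injective (+-cancelʳ-≡ _ _ _ (trans (sym e) f))

⟦⟧≤1 : ∀ β → ⟦ β ⟧ ≤ 1
⟦⟧≤1 true  = ≤-refl
⟦⟧≤1 false = z≤n

-- Heights at the four corners of a cell: rightwards or downwards along an edge the height grows by
-- one exactly when a pipe meets that edge.
record Corner (t : Tile) (nw ne sw se : ℕ) : Set where
  constructor mkCorner
  field
    left≡   : sw ≡ ⟦ left t ⟧ + nw
    top≡    : ne ≡ ⟦ top t ⟧ + nw
    bottom≡ : se ≡ ⟦ bottom t ⟧ + sw
    right≡  : se ≡ ⟦ right t ⟧ + ne

-- R a b counts the pipes through the bottom edges of row a - 1 in columns < b,
-- and r is the same count for the Rothe pipe dream.
record Profile {n} (S : Shape n) : Set where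
  open Shape S
  open Rank S
  field
    τ      : ℕ → ℕ → Tile
    R      : ℕ → ℕ → ℕ
    R-top  : ∀ {b} → b ≤ n → R 0 b ≡ 0
    R-left : ∀ a → R a 0 ≡ 0
    R-out  : ∀ {a b} → a ≤ n → b ≤ n → Λ a ≤ b → R a b ≡ r a b
    corner : ∀ {a b} → a < n → b < n → Corner (τ a b) (R a b) (R a (suc b)) (R (suc a) b) (R (suc a) (suc b))
    noncrossing : ∀ {a b} → a < n → b < Λ a → τ a b ≢ crossing

-- The label on an edge between corners of heights lo and lo + 1 is the
-- (lo + 1)-st value in the increasing enumeration with counting function ρ.
Between : (ℕ → ℕ) → Maybe ℕ → ℕ → ℕ → Set
Between ρ m lo hi = ∀ {x} → m ≡ just x → ρ x ≡ lo × ρ (suc x) ≡ hi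

module _ {ρ : ℕ → ℕ} {nw ne sw se : ℕ} where

  -- At a crossing the right edge starts one higher than the top edge, yet it carries the smaller
  -- label, against monotonicity of `ρ`. In any other tile a label joins two edges that span the
  -- same heights.
  step-backward : ∀ {t l b r u} → (∀ {x y} → x ≤ y → ρ x ≤ ρ y) → Step t l b r u → Corner t nw ne sw se →
    Between ρ r ne se → Between ρ u nw ne → t ≢ crossing × Between ρ l nw sw × Between ρ b sw se
  step-backward mono down-elbow (mkCorner l≡ t≡ b≡ r≡) R U = (λ ()) , (λ ()) ,
    λ { refl → trans (proj₁ (R refl)) (trans t≡ (sym l≡)) , proj₂ (R refl) }
  step-backward mono up-elbow (mkCorner l≡ t≡ b≡ r≡) R U = (λ ()) ,
    (λ { refl → proj₁ (U refl) , trans (proj₂ (U refl)) (trans (sym r≡) b≡) }) , λ ()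
  step-backward mono blank _ R U = (λ ()) , (λ ()) , λ ()
  step-backward mono horizontal (mkCorner l≡ t≡ b≡ r≡) R U = (λ ()) ,
    (λ { refl → trans (proj₁ (R refl)) t≡ , trans (proj₂ (R refl)) b≡ }) , λ ()
  step-backward mono vertical (mkCorner l≡ t≡ b≡ r≡) R U = (λ ()) , (λ ()) ,
    λ { refl → trans (proj₁ (U refl)) (sym l≡) , trans (proj₂ (U refl)) (sym r≡) }
  step-backward mono (crossing {x} {y}) (mkCorner l≡ t≡ b≡ r≡) R U =
    contradiction (subst₂ _≤_ (trans (proj₁ (R refl)) t≡) (proj₁ (U refl)) (mono (m⊓n≤m⊔n x y))) 1+n≰n

  step-forward : ∀ {t l b r u} → Step t l b r u → Corner t nw ne sw se → t ≢ crossing →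
    Between ρ l nw sw → Between ρ b sw se → Between ρ r ne se × Between ρ u nw ne
  step-forward down-elbow (mkCorner l≡ t≡ b≡ r≡) _ L B =
    (λ { refl → trans (proj₁ (B refl)) (trans l≡ (sym t≡)) , proj₂ (B refl) }) , λ ()
  step-forward up-elbow (mkCorner l≡ t≡ b≡ r≡) _ L B =
    (λ ()) , λ { refl → proj₁ (L refl) , trans (proj₂ (L refl)) (trans (sym b≡) r≡) }
  step-forward blank _ _ L B = (λ ()) , λ ()
  step-forward horizontal (mkCorner l≡ t≡ b≡ r≡) _ L B =
    (λ { refl → trans (proj₁ (L refl)) (sym t≡) , trans (proj₂ (L refl)) (sym b≡) }) , λ ()
  step-forward vertical (mkCorner l≡ t≡ b≡ r≡) _ L B =
    (λ ()) , λ { refl → trans (proj₁ (B refl)) l≡ , trans (proj₂ (B refl)) r≡ }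
  step-forward crossing _ ≢c L B = contradiction refl ≢c

-- The right edge follows from the other three, since a tile lets out as many pipes as it takes in.
step-corner : ∀ {t l b r u} → Step t l b r u → ∀ {nw ne sw se} → sw ≡ ⟦ is-just l ⟧ + nw →
  ne ≡ ⟦ is-just u ⟧ + nw → se ≡ ⟦ is-just b ⟧ + sw → Corner t nw ne sw se
step-corner down-elbow refl refl refl = mkCorner refl refl refl refl
step-corner up-elbow   refl refl refl = mkCorner refl refl refl refl
step-corner blank      refl refl refl = mkCorner refl refl refl refl
step-corner horizontal refl refl refl = mkCorner refl refl refl refl
step-corner vertical   refl refl refl = mkCorner refl refl refl refl
step-corner crossing   refl refl refl = mkCorner refl refl refl refl

-- Labels only move north and east, so none is found to the left of its starting column.
step-bounded : ∀ {t l b r u} → Step t l b r u → ∀ {c} →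
  (∀ {x} → l ≡ just x → x < c) → (∀ {x} → b ≡ just x → x ≤ c) →
  (∀ {x} → r ≡ just x → x < suc c) × (∀ {x} → u ≡ just x → x ≤ c)
step-bounded down-elbow L B = (λ { refl → s≤s (B refl) }) , λ ()
step-bounded up-elbow   L B = (λ ()) , λ { refl → <⇒≤ (L refl) }
step-bounded blank      L B = (λ ()) , λ ()
step-bounded horizontal L B = (λ { refl → m≤n⇒m≤1+n (L refl) }) , λ ()
step-bounded vertical   L B = (λ ()) , λ { refl → B refl }
step-bounded (crossing {x} {y}) L B =
  (λ { refl → s≤s (≤-trans (m⊓n≤n x y) (B refl)) }) , λ { refl → ⊔-lub (<⇒≤ (L refl)) (B refl) }

-- Labels of a pipe dream compared with the Rothe pipe dream.

module Labels {n} (S : Shape n) {P : Tiling n} (lab : Labelling P) where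
  open Shape S
  open Rank S
  open Labelling lab

  Below : ℕ → Set
  Below a = ∀ {b x} → b < n → w a b ≡ just x → x ≤ b

  h-bounded′ : ∀ {a} → a < n → Below (suc a) → ∀ {b} → b ≤ n → ∀ {x} → h a b ≡ just x → x < b
  h-bounded′ {a} a<n below = upward (λ b → ∀ {x} → h a b ≡ just x → x < b)
    (λ e → case trans (sym (h-start a<n)) e of λ ())
    λ b<n ih → proj₁ (step-bounded (step a<n b<n) ih (below b<n))

  w-bounded : ∀ {a} → a ≤ n → Below a
  w-bounded = downward Below (λ b<n e → ≤-reflexive (sym (just-injective (trans (sym (w-bot b<n)) e))))
    λ a<n below b<n → proj₂ (step-bounded (step a<n b<n) (h-bounded′ a<n below (<⇒≤ b<n)) (below b<n))

  h-bounded : ∀ {a b x} → a < n → b ≤ n → h a b ≡ just x → x < b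
  h-bounded a<n b≤n = h-bounded′ a<n (w-bounded a<n) b≤n

  -- The edge labels of the Rothe pipe dream: pipe `b` climbs column `b` up to row `u b` and then
  -- runs right, so row `a` carries `v a` to the right of column `v a`.
  RotheH RotheV : ℕ → ℕ → Maybe ℕ → Set
  RotheH a b m = (v a < b × m ≡ just (v a)) ⊎ (b ≤ v a × m ≡ nothing)
  RotheV a b m = (u b < a × m ≡ just b) ⊎ (a ≤ u b × m ≡ nothing)

  not-dot-row : ∀ {a b} → a < u b → v a ≢ b
  not-dot-row {a} a<ub va≡b = <-irrefl (trans (sym (u∘v a)) (cong u va≡b)) a<ub

  not-dot-col : ∀ {a b} → v a ≢ b → u b ≢ a
  not-dot-col {a} {b} va≢b ub≡a = va≢b (trans (cong v (sym ub≡a)) (v∘u b))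

  -- At a crossing the label from the left is smaller than the column index, which
  -- is the label from below, so nothing is exchanged.
  rothe-backward : ∀ {t l bo r u′ a b} → Step t l bo r u′ → Λ a ≤ b → (∀ {x} → l ≡ just x → x < b) →
    RotheV (suc a) b bo → RotheH a (suc b) r → RotheH a b l × RotheV a b u′
  rothe-backward {a = a} down-elbow Λ≤b L (inj₁ (ub≤a , refl)) (inj₁ (va≤b , b≡va)) =
    inj₂ (≤-reflexive (just-injective b≡va) , refl) ,
    inj₂ (≤-reflexive (trans (sym (u∘v a)) (cong u (sym (just-injective b≡va)))) , refl)
  -- An up-elbow, like the blank below, would sit on a box of the diagram outside `Λ`.
  rothe-backward up-elbow Λ≤b L (inj₂ (a<ub , refl)) (inj₂ (b<va , refl)) =
    contradiction (outside Λ≤b b<va) (<⇒≱ a<ub)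
  rothe-backward blank Λ≤b L (inj₂ (a<ub , refl)) (inj₂ (b<va , refl)) =
    contradiction (outside Λ≤b b<va) (<⇒≱ a<ub)
  rothe-backward horizontal Λ≤b L (inj₂ (a<ub , refl)) (inj₁ (va≤b , refl)) =
    inj₁ (≤∧≢⇒< (s≤s⁻¹ va≤b) (not-dot-row a<ub) , refl) , inj₂ (<⇒≤ a<ub , refl)
  rothe-backward vertical Λ≤b L (inj₁ (ub≤a , refl)) (inj₂ (b<va , refl)) =
    inj₂ (<⇒≤ b<va , refl) , inj₁ (≤∧≢⇒< (s≤s⁻¹ ub≤a) (not-dot-col (>⇒≢ b<va)) , refl)
  rothe-backward (crossing {x} {b}) Λ≤b L (inj₁ (ub≤a , refl)) (inj₁ (va≤b , e)) =
    inj₁ (va<b , cong just x≡va) ,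
    inj₁ (≤∧≢⇒< (s≤s⁻¹ ub≤a) (not-dot-col (<⇒≢ va<b)) , cong just (m≤n⇒m⊔n≡n (<⇒≤ (L refl))))
    where
    x≡va = trans (sym (m≤n⇒m⊓n≡m (<⇒≤ (L refl)))) (just-injective e)
    va<b = subst (_< b) x≡va (L refl)

  -- The last two hypotheses prescribe which outgoing edges are met by pipes. This fixes the tile,
  -- and at a crossing `v a` is smaller than `b`, so the labels run straight on.
  rothe-forward : ∀ {t l bo r u′ a b} → Step t l bo r u′ → RotheH a b l → RotheV (suc a) b bo →
    (v a < suc b × is-just r ≡ true) ⊎ (suc b ≤ v a × is-just r ≡ false) →
    (u b < a × is-just u′ ≡ true) ⊎ (a ≤ u b × is-just u′ ≡ false) → RotheH a (suc b) r × RotheV a b u′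
  rothe-forward down-elbow (inj₂ (b≤va , refl)) (inj₁ (_ , refl)) (inj₁ (va≤b , _)) (inj₂ (a≤ub , _)) =
    inj₁ (va≤b , cong just (≤-antisym b≤va (s≤s⁻¹ va≤b))) , inj₂ (a≤ub , refl)
  rothe-forward up-elbow (inj₁ (va<b , refl)) _ (inj₂ (b<va , _)) _ = contradiction b<va (<-asym va<b)
  rothe-forward blank _ _ (inj₂ (b<va , _)) (inj₂ (a≤ub , _)) = inj₂ (b<va , refl) , inj₂ (a≤ub , refl)
  rothe-forward horizontal (inj₁ (_ , refl)) _ (inj₁ (va≤b , _)) (inj₂ (a≤ub , _)) =
    inj₁ (va≤b , refl) , inj₂ (a≤ub , refl)
  rothe-forward vertical _ (inj₁ (_ , refl)) (inj₂ (b<va , _)) (inj₁ (ub<a , _)) =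
    inj₂ (b<va , refl) , inj₁ (ub<a , refl)
  rothe-forward crossing (inj₁ (va<b , refl)) (inj₁ (_ , refl)) (inj₁ (va≤b , _)) (inj₁ (ub<a , _)) =
    inj₁ (va≤b , cong just (m≤n⇒m⊓n≡m (<⇒≤ va<b))) , inj₁ (ub<a , cong just (m≤n⇒m⊔n≡n (<⇒≤ va<b)))

  R : ℕ → ℕ → ℕ
  R a zero    = 0
  R a (suc b) = ⟦ is-just (w a b) ⟧ + R a b

  R-row : ∀ {a} → a < n → ∀ {b} → b ≤ n → R (suc a) b ≡ ⟦ is-just (h a b) ⟧ + R a b
  R-row {a} a<n = upward (λ b → R (suc a) b ≡ ⟦ is-just (h a b) ⟧ + R a b)
    (sym (trans (+-identityʳ _) (cong (⟦_⟧ ∘ is-just) (h-start a<n))))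
    λ {b} b<n ih → let s = step a<n b<n in
      trans (Corner.right≡ (step-corner s ih refl refl)) (cong (λ z → ⟦ z ⟧ + R a (suc b)) (sym (step-right s)))

  corner : ∀ {a b} → a < n → b < n → Corner (tileAt P a b) (R a b) (R a (suc b)) (R (suc a) b) (R (suc a) (suc b))
  corner a<n b<n = step-corner (step a<n b<n) (R-row a<n (<⇒≤ b<n)) refl refl

-- Pipe dreams with Demazure product `v`.

module Analysis {n} (S : Shape n) {P : Tiling n} (bpd : IsBPD P)
  (exits : ∀ i → labelℕ (∂ P i) ≡ just (Shape.v S (toℕ i))) where
  open Shape S
  open Rank S

  private
    lab = labelling bpd
  open Labelling lab
  open Labels S lab

  h-exit : ∀ {a} → a < n → h a n ≡ just (v a)
  h-exit = onFin {Q = λ a → h a n ≡ just (v a)} λ i → trans (h-end i) (exits i)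

  w-top : ∀ {b} → b < n → w 0 b ≡ nothing
  w-top {b} b<n with w 0 b | trans (step-top (step (m<n⇒0<n b<n) b<n)) (top-borderℕ bpd b<n)
  ... | nothing | _ = refl

  OutV : ℕ → Set
  OutV a = ∀ {b} → Λ a ≤ b → b < n → RotheV a b (w a b)

  outH′ : ∀ {a} → a < n → OutV (suc a) → ∀ {b} → b ≤ n → Λ a ≤ b → RotheH a b (h a b)
  outH′ {a} a<n below = downward (λ b → Λ a ≤ b → RotheH a b (h a b))
    (λ _ → inj₁ (v<n a<n , h-exit a<n))
    λ b<n ih Λ≤b → proj₁ (rothe-backward (step a<n b<n) Λ≤b (h-bounded a<n (<⇒≤ b<n))
      (below (≤-trans (Λ-anti (n≤1+n a)) Λ≤b) b<n) (ih (m≤n⇒m≤1+n Λ≤b)))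

  outV : ∀ {a} → a ≤ n → OutV a
  outV = downward OutV (λ _ b<n → inj₁ (u<n b<n , w-bot b<n))
    λ {a} a<n below Λ≤b b<n → proj₂ (rothe-backward (step a<n b<n) Λ≤b (h-bounded a<n (<⇒≤ b<n))
      (below (≤-trans (Λ-anti (n≤1+n a)) Λ≤b) b<n) (outH′ a<n below b<n (m≤n⇒m≤1+n Λ≤b)))

  outH : ∀ {a b} → a < n → b ≤ n → Λ a ≤ b → RotheH a b (h a b)
  outH a<n b≤n = outH′ a<n (outV a<n) b≤n

  R-top : ∀ {b} → b ≤ n → R 0 b ≡ 0
  R-top {zero}  _   = refl
  R-top {suc b} b<n = cong₂ _+_ (cong (⟦_⟧ ∘ is-just) (w-top b<n)) (R-top (<⇒≤ b<n))

  R-rightmost : ∀ {a} → a ≤ n → R a n ≡ a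
  R-rightmost {zero}  _   = R-top ≤-refl
  R-rightmost {suc a} a<n = trans (R-row a<n ≤-refl)
    (cong₂ _+_ (cong (⟦_⟧ ∘ is-just) (h-exit a<n)) (R-rightmost (<⇒≤ a<n)))

  -- Both heights are `a` at the right border, and leftwards they drop at the same edges because the
  -- labels there are those of the Rothe pipe dream.
  R-out : ∀ {a b} → a ≤ n → b ≤ n → Λ a ≤ b → R a b ≡ r a b
  R-out {a} a≤n = downward (λ b → Λ a ≤ b → R a b ≡ r a b)
    (λ _ → trans (R-rightmost a≤n) (sym (r-rightmost a≤n)))
    λ {b} b<n ih Λ≤b → back b (ih (m≤n⇒m≤1+n Λ≤b)) (outV a≤n Λ≤b b<n)
    where
    back : ∀ b → R a (suc b) ≡ r a (suc b) → RotheV a b (w a b) → R a b ≡ r a b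
    back b e (inj₁ (ub<a , wj)) = suc-injective (begin
      suc (R a b)               ≡⟨ cong (λ m → ⟦ is-just m ⟧ + R a b) (sym wj) ⟩
      R a (suc b)               ≡⟨ e ⟩
      r a (suc b)               ≡⟨ r-col-< ub<a ⟩
      suc (r a b)               ∎)
      where open ≡-Reasoning
    back b e (inj₂ (a≤ub , wn)) = begin
      R a b                     ≡⟨ cong (λ m → ⟦ is-just m ⟧ + R a b) (sym wn) ⟩
      R a (suc b)               ≡⟨ e ⟩
      r a (suc b)               ≡⟨ r-col-≥ a≤ub ⟩
      r a b                     ∎
      where open ≡-Reasoning

  -- Within `Λ` the labels above row `a` are the first values of `v` on the earlier rows, in
  -- increasing order.
  InV : ℕ → Set
  InV a = ∀ {b} → b < Λ a → Between (r a) (w a b) (R a b) (R a (suc b))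

  -- By `vexillary` a label `x` that exits above row `a` is smaller than `v a`, so admitting `v a`
  -- to the enumeration leaves the place of `x` unchanged.
  lower-row : ∀ {a b} → a ≤ n → b < Λ a → Between (r a) (w a b) (R a b) (R a (suc b)) →
    Between (r (suc a)) (w a b) (R a b) (R a (suc b))
  lower-row {a} {b} a≤n b<Λ W {x} e =
    trans (r-suc-≥ (<⇒≤ x<va)) (proj₁ (W e)) , trans (r-suc-≥ x<va) (proj₂ (W e))
    where
    ux<a : u x < a
    ux<a = r-col-inv (trans (proj₂ (W e)) (trans (cong (λ m → ⟦ is-just m ⟧ + R a b) e) (cong suc (sym (proj₁ (W e))))))
    x<va : x < v a
    x<va = subst (_< v a) (v∘u x) (vexillary ux<a (subst (_< Λ a) (sym (v∘u x))
             (≤-<-trans (w-bounded a≤n (<-≤-trans b<Λ (Λ≤n a)) e) b<Λ)))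

  module _ {a : ℕ} (a<n : a < n) (inV : InV a) where

    -- A label at the end of `Λ` is `v a`, and `r-at-dot` and `r-past-dot` make it the last value
    -- below `Λ a`.
    inH-start : Between (r (suc a)) (h a (Λ a)) (R a (Λ a)) (R (suc a) (Λ a))
    inH-start e with outH a<n (Λ≤n a) ≤-refl
    ... | inj₂ (_ , hn) = case trans (sym hn) e of λ ()
    ... | inj₁ (va<Λ , hj) with refl ← just-injective (trans (sym hj) e) =
      trans (r-suc-≥ ≤-refl) (trans (r-at-dot va<Λ) (sym (R-out (<⇒≤ a<n) (Λ≤n a) ≤-refl))) ,
      trans (r-past-dot va<Λ) (sym (R-out a<n (Λ≤n a) (Λ-anti (n≤1+n a))))

    backward : ∀ {b} → b < Λ a → Between (r (suc a)) (h a (suc b)) (R a (suc b)) (R (suc a) (suc b)) →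
      tileAt P a b ≢ crossing × Between (r (suc a)) (h a b) (R a b) (R (suc a) b) ×
      Between (r (suc a)) (w (suc a) b) (R (suc a) b) (R (suc a) (suc b))
    backward b<Λ H = let b<n = <-≤-trans b<Λ (Λ≤n a) in
      step-backward (r-monoʳ (suc a)) (step a<n b<n) (corner a<n b<n) H (lower-row (<⇒≤ a<n) b<Λ (inV b<Λ))

    inH : ∀ {b} → b ≤ Λ a → Between (r (suc a)) (h a b) (R a b) (R (suc a) b)
    inH = downward (λ b → Between (r (suc a)) (h a b) (R a b) (R (suc a) b))
      inH-start λ b<Λ H → proj₁ (proj₂ (backward b<Λ H))

  inV : ∀ {a} → a ≤ n → InV a
  inV = upward InV (λ b<Λ e → case trans (sym (w-top (<-≤-trans b<Λ (Λ≤n 0)))) e of λ ())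
    λ {a} a<n iv b<Λ → let b<Λa = <-≤-trans b<Λ (Λ-anti (n≤1+n a)) in
      proj₂ (proj₂ (backward a<n iv b<Λa (inH a<n iv b<Λa)))

  profile : Profile S
  profile = record
    { τ      = tileAt P
    ; R      = λ a b → R a b
    ; R-top  = R-top
    ; R-left = λ a → refl
    ; R-out  = R-out
    ; corner = corner
    ; noncrossing = λ a<n b<Λ → proj₁ (backward a<n (inV (<⇒≤ a<n)) b<Λ (inH a<n (inV (<⇒≤ a<n)) b<Λ))
    }

-- Profiles are determined by their blanks

decode : (l b r : Bool) → Tile
decode true  true  _     = crossing
decode true  false true  = horizontal
decode true  false false = up-elbow
decode false true  true  = down-elbow
decode false true  false = vertical
decode false false _     = blank

decode-edges : ∀ t → decode (left t) (bottom t) (right t) ≡ t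
decode-edges down-elbow = refl
decode-edges up-elbow   = refl
decode-edges crossing   = refl
decode-edges blank      = refl
decode-edges horizontal = refl
decode-edges vertical   = refl

corner-unique : ∀ {t t′ nw ne sw se} → Corner t nw ne sw se → Corner t′ nw ne sw se → t ≡ t′
corner-unique {t} {t′} c c′ = begin
  t                                       ≡⟨ sym (decode-edges t) ⟩
  decode (left t) (bottom t) (right t)    ≡⟨ cong₂ (λ l b → decode l b (right t)) (⟦⟧-cancel (left≡ c) (left≡ c′)) (⟦⟧-cancel (bottom≡ c) (bottom≡ c′)) ⟩
  decode (left t′) (bottom t′) (right t)  ≡⟨ cong (decode (left t′) (bottom t′)) (⟦⟧-cancel (right≡ c) (right≡ c′)) ⟩
  decode (left t′) (bottom t′) (right t′) ≡⟨ decode-edges t′ ⟩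
  t′                                      ∎
  where
  open ≡-Reasoning
  open Corner

corner-blank : ∀ {t nw ne sw se} → Corner t nw ne sw se → t ≡ blank → se ≡ nw
corner-blank c refl = trans (Corner.bottom≡ c) (Corner.left≡ c)

corner-blank⁻ : ∀ {t nw ne sw se} → Corner t nw ne sw se → se ≡ nw → t ≡ blank
corner-blank⁻ {blank}      c e = refl
corner-blank⁻ {down-elbow} (mkCorner refl refl refl _) e = contradiction e 1+n≢n
corner-blank⁻ {up-elbow}   (mkCorner refl refl refl _) e = contradiction e 1+n≢n
corner-blank⁻ {crossing}   (mkCorner refl refl refl _) e = contradiction (≤-reflexive e) (<⇒≱ (m≤n⇒m≤1+n ≤-refl))
corner-blank⁻ {horizontal} (mkCorner refl refl refl _) e = contradiction e 1+n≢n
corner-blank⁻ {vertical}   (mkCorner refl refl refl _) e = contradiction e 1+n≢n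

corner-nonblank : ∀ {t nw ne sw se} → Corner t nw ne sw se → t ≢ blank → t ≢ crossing → se ≡ suc nw
corner-nonblank {blank}      c ≢b ≢c = contradiction refl ≢b
corner-nonblank {crossing}   c ≢b ≢c = contradiction refl ≢c
corner-nonblank {down-elbow} (mkCorner refl refl refl _) _ _ = refl
corner-nonblank {up-elbow}   (mkCorner refl refl refl _) _ _ = refl
corner-nonblank {horizontal} (mkCorner refl refl refl _) _ _ = refl
corner-nonblank {vertical}   (mkCorner refl refl refl _) _ _ = refl

blank? : ∀ (t : Tile) → Dec (t ≡ blank)
blank? blank      = yes refl
blank? down-elbow = no λ ()
blank? up-elbow   = no λ ()
blank? crossing   = no λ ()
blank? horizontal = no λ ()
blank? vertical   = no λ ()

module ProfileProperties {n} {S : Shape n} (prof : Profile S) where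
  open Shape S
  open Rank S
  open Profile prof

  -- Outside `Λ` the heights are those of `r`. No pipe on the right edge then means `b < v a`, none
  -- on the top edge means `a ≤ u b`, and `outside` forces `u b ≡ a`, a contradiction.
  blank-inside : ∀ {a b} → a < n → b < n → τ a b ≡ blank → b < Λ a
  blank-inside {a} {b} a<n b<n t≡ with <-≤-connex b (Λ a)
  ... | inj₁ b<Λ = b<Λ
  ... | inj₂ Λ≤b = ⊥-elim (no-dot (r-suc-≥⁻ e₁) (r-col-≥⁻ e₂))
    where
    c = corner a<n b<n
    e₁ : r (suc a) (suc b) ≡ r a (suc b)
    e₁ = begin
      r (suc a) (suc b) ≡⟨ sym (R-out a<n b<n (≤-trans (Λ-anti (n≤1+n a)) (m≤n⇒m≤1+n Λ≤b))) ⟩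
      R (suc a) (suc b) ≡⟨ Corner.right≡ c ⟩
      _                 ≡⟨ cong (λ t → ⟦ right t ⟧ + R a (suc b)) t≡ ⟩
      R a (suc b)       ≡⟨ R-out (<⇒≤ a<n) b<n (m≤n⇒m≤1+n Λ≤b) ⟩
      r a (suc b)       ∎
      where open ≡-Reasoning
    e₂ : r a (suc b) ≡ r a b
    e₂ = begin
      r a (suc b) ≡⟨ sym (R-out (<⇒≤ a<n) b<n (m≤n⇒m≤1+n Λ≤b)) ⟩
      R a (suc b) ≡⟨ Corner.top≡ c ⟩
      _           ≡⟨ cong (λ t → ⟦ top t ⟧ + R a b) t≡ ⟩
      R a b       ≡⟨ R-out (<⇒≤ a<n) (<⇒≤ b<n) Λ≤b ⟩
      r a b       ∎
      where open ≡-Reasoning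
    r-suc-≥⁻ : r (suc a) (suc b) ≡ r a (suc b) → suc b ≤ v a
    r-suc-≥⁻ e = ≮⇒≥ λ lt → 1+n≢n (trans (sym (r-suc-< lt)) e)
    r-col-≥⁻ : r a (suc b) ≡ r a b → a ≤ u b
    r-col-≥⁻ e = ≮⇒≥ λ lt → 1+n≢n (trans (sym (r-col-< lt)) e)
    no-dot : suc b ≤ v a → a ≤ u b → ⊥
    no-dot b<va a≤ub = <-irrefl (trans (sym (v∘u b)) (cong v (≤-antisym (outside Λ≤b b<va) a≤ub))) b<va

  R-diag-≤ : ∀ {a b} → a < n → b < Λ a → R (suc a) (suc b) ≤ suc (R a b)
  R-diag-≤ {a} {b} a<n b<Λ with c ← corner a<n (<-≤-trans b<Λ (Λ≤n a)) | blank? (τ a b)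
  ... | yes t≡ = ≤-trans (≤-reflexive (corner-blank c t≡)) (n≤1+n _)
  ... | no t≢  = ≤-reflexive (corner-nonblank c t≢ (noncrossing a<n b<Λ))

  R-diag-≥ : ∀ {a b} → a < n → b < n → R a b ≤ R (suc a) (suc b)
  R-diag-≥ a<n b<n with mkCorner l≡ _ b≡ _ ← corner a<n b<n =
    ≤-trans (m≤n+m _ _) (≤-trans (≤-reflexive (sym l≡)) (≤-trans (m≤n+m _ _) (≤-reflexive (sym b≡))))

  R-col-≥ : ∀ {a b} → a ≤ n → b < n → R a b ≤ R a (suc b)
  R-col-≥ {zero}  _   b<n = ≤-reflexive (trans (R-top (<⇒≤ b<n)) (sym (R-top b<n)))
  R-col-≥ {suc a} a<n b<n = ≤-trans (m≤n+m _ _) (≤-reflexive (sym (Corner.bottom≡ (corner a<n b<n))))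

  R-row-≥ : ∀ {a b} → a < n → b < n → R a (suc b) ≤ R (suc a) (suc b)
  R-row-≥ a<n b<n = ≤-trans (m≤n+m _ _) (≤-reflexive (sym (Corner.right≡ (corner a<n b<n))))

  R-monoʳ : ∀ {a b c} → a ≤ n → b ≤ c → c ≤ n → R a b ≤ R a c
  R-monoʳ {c = zero} a≤n z≤n _ = ≤-refl
  R-monoʳ {c = suc c} a≤n b≤c c<n with m≤n⇒m<n∨m≡n b≤c
  ... | inj₁ b<c  = ≤-trans (R-monoʳ a≤n (s≤s⁻¹ b<c) (<⇒≤ c<n)) (R-col-≥ a≤n c<n)
  ... | inj₂ refl = ≤-refl

  R≤a : ∀ {a b} → a ≤ n → b ≤ n → R a b ≤ a
  R≤a {zero}          _   b≤n = ≤-reflexive (R-top b≤n)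
  R≤a {suc a} {zero}  _   _   = ≤-trans (≤-reflexive (R-left _)) z≤n
  R≤a {suc a} {suc b} a<n b<n = ≤-trans (≤-reflexive (Corner.right≡ (corner a<n b<n)))
    (+-mono-≤ (⟦⟧≤1 _) (R≤a (<⇒≤ a<n) b<n))

  R≤b : ∀ {a b} → a ≤ n → b ≤ n → R a b ≤ b
  R≤b {zero}          _   b≤n = ≤-trans (≤-reflexive (R-top b≤n)) z≤n
  R≤b {suc a} {zero}  _   _   = ≤-reflexive (R-left _)
  R≤b {suc a} {suc b} a<n b<n = ≤-trans (≤-reflexive (Corner.bottom≡ (corner a<n b<n)))
    (+-mono-≤ (⟦⟧≤1 _) (R≤b a<n (<⇒≤ b<n)))

  R-diag : ∀ m {a b} → (∀ {m′} → m′ < m → m′ + b < Λ (m′ + a)) → R (m + a) (m + b) ≤ m + R a b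
  R-diag zero    inside = ≤-refl
  R-diag (suc m) inside = ≤-trans (R-diag-≤ (Λ-row (inside ≤-refl)) (inside ≤-refl))
    (s≤s (R-diag m (inside ∘ m≤n⇒m≤1+n)))

module _ {n} {S : Shape n} (p p′ : Profile S) where
  open Shape S
  private
    module P = Profile p
    module P′ = Profile p′

  -- Along a diagonal inside `Λ` the height stays at a blank and otherwise grows by exactly one, for
  -- want of crossings.
  R-from-blanks : (∀ {a b} → a < n → b < Λ a → P.τ a b ≡ blank → P′.τ a b ≡ blank) →
    (∀ {a b} → a < n → b < Λ a → P′.τ a b ≡ blank → P.τ a b ≡ blank) →
    ∀ {a b} → a ≤ n → b ≤ n → P.R a b ≡ P′.R a b
  R-from-blanks to from {zero}  {b}     _   b≤n = trans (P.R-top b≤n) (sym (P′.R-top b≤n))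
  R-from-blanks to from {suc a} {zero}  _   _   = trans (P.R-left _) (sym (P′.R-left _))
  R-from-blanks to from {suc a} {suc b} a<n b<n with <-≤-connex b (Λ a)
  ... | inj₂ Λ≤b = trans (P.R-out a<n b<n Λ≤1+b) (sym (P′.R-out a<n b<n Λ≤1+b))
    where Λ≤1+b = ≤-trans (Λ-anti (n≤1+n a)) (m≤n⇒m≤1+n Λ≤b)
  ... | inj₁ b<Λ with ih ← R-from-blanks to from {a} {b} (<⇒≤ a<n) (<⇒≤ b<n) | blank? (P.τ a b)
  ...   | yes t≡ = trans (corner-blank (P.corner a<n b<n) t≡)
                     (trans ih (sym (corner-blank (P′.corner a<n b<n) (to a<n b<Λ t≡))))
  ...   | no t≢  = trans (corner-nonblank (P.corner a<n b<n) t≢ (P.noncrossing a<n b<Λ)) (trans (cong suc ih)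
                     (sym (corner-nonblank (P′.corner a<n b<n) (t≢ ∘ from a<n b<Λ) (P′.noncrossing a<n b<Λ))))

  τ-from-R : (∀ {a b} → a ≤ n → b ≤ n → P.R a b ≡ P′.R a b) → ∀ {a b} → a < n → b < n → P.τ a b ≡ P′.τ a b
  τ-from-R e {a} {b} a<n b<n = corner-unique (P.corner a<n b<n) c
    where
    c : Corner (P′.τ a b) (P.R a b) (P.R a (suc b)) (P.R (suc a) b) (P.R (suc a) (suc b))
    c rewrite e (<⇒≤ a<n) (<⇒≤ b<n) | e (<⇒≤ a<n) b<n | e a<n (<⇒≤ b<n) | e a<n b<n = P′.corner a<n b<n

-- From profiles to pipe dreams

module Construction {n} (S : Shape n) (prof : Profile S) where
  open Shape S
  open Rank S
  open Profile prof
  open ProfileProperties prof using (R-monoʳ)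

  P : Tiling n
  P = tilingOf n τ

  R-rightmost : ∀ {a} → a ≤ n → R a n ≡ a
  R-rightmost {a} a≤n = trans (R-out a≤n ≤-refl (Λ≤n a)) (r-rightmost a≤n)

  R-bottom : ∀ {b} → b ≤ n → R n b ≡ b
  R-bottom b≤n = trans (R-out ≤-refl b≤n (subst (_≤ _) (sym Λ-n) z≤n)) (r-bottom b≤n)

  cornerF : ∀ (i j : Fin n) → let a = toℕ i; b = toℕ j in
    Corner (tile P i j) (R a b) (R a (suc b)) (R (suc a) b) (R (suc a) (suc b))
  cornerF i j rewrite tile-tilingOf τ i j = corner (toℕ<n i) (toℕ<n j)

  open Corner

  -- Neighbouring tiles read their common edge off the same two heights; the borders come from the
  -- boundary values of `R`.
  is-BPD : IsBPD P
  is-BPD = record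
    { row-match = λ i {j} {j′} e → ⟦⟧-cancel (right≡ (cornerF i j))
        (subst (λ z → R (suc (toℕ i)) z ≡ ⟦ left (tile P i j′) ⟧ + R (toℕ i) z) e (left≡ (cornerF i j′)))
    ; col-match = λ {i} {i′} j e → ⟦⟧-cancel (bottom≡ (cornerF i j))
        (subst (λ z → R z (suc (toℕ j)) ≡ ⟦ top (tile P i′ j) ⟧ + R z (toℕ j)) e (top≡ (cornerF i′ j)))
    ; left-border = λ i j e → ⟦⟧-cancel
        (subst (λ z → R (suc (toℕ i)) z ≡ ⟦ left (tile P i j) ⟧ + R (toℕ i) z) (suc-injective e) (left≡ (cornerF i j)))
        (trans (R-left _) (sym (R-left _)))
    ; right-border = λ i j e → ⟦⟧-cancel
        (subst (λ z → R (suc (toℕ i)) z ≡ ⟦ right (tile P i j) ⟧ + R (toℕ i) z) e (right≡ (cornerF i j)))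
        (trans (R-rightmost (toℕ<n i)) (cong suc (sym (R-rightmost (<⇒≤ (toℕ<n i))))))
    ; top-border = λ i j e → ⟦⟧-cancel
        (subst (λ z → R z (suc (toℕ j)) ≡ ⟦ top (tile P i j) ⟧ + R z (toℕ j)) (suc-injective e) (top≡ (cornerF i j)))
        (trans (R-top (toℕ<n j)) (sym (R-top (<⇒≤ (toℕ<n j)))))
    ; bot-border = λ i j e → ⟦⟧-cancel
        (subst (λ z → R z (suc (toℕ j)) ≡ ⟦ bottom (tile P i j) ⟧ + R z (toℕ j)) e (bottom≡ (cornerF i j)))
        (trans (R-bottom (toℕ<n j)) (cong suc (sym (R-bottom (<⇒≤ (toℕ<n j))))))
    }

  tileAt-P : ∀ {a b} → a < n → b < n → tileAt P a b ≡ τ a b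
  tileAt-P {a} {b} a<n b<n = onFin {Q = λ a → tileAt P a b ≡ τ a b}
    (λ i → onFin {Q = λ b → tileAt P (toℕ i) b ≡ τ (toℕ i) b}
      (λ j → trans (sym (tile≡tileAt P i j)) (tile-tilingOf τ i j)) b<n) a<n

  private
    lab = labelling is-BPD
  open Labelling lab
  open Labels S lab hiding (R; R-row; corner)

  cornerP : ∀ {a b} → a < n → b < n →
    Corner (tileAt P a b) (R a b) (R a (suc b)) (R (suc a) b) (R (suc a) (suc b))
  cornerP a<n b<n = subst (λ t → Corner t _ _ _ _) (sym (tileAt-P a<n b<n)) (corner a<n b<n)

  R-row : ∀ {a b} → a < n → b ≤ n → R (suc a) b ≡ ⟦ is-just (h a b) ⟧ + R a b
  R-row {a} {zero}  a<n _   = trans (R-left _) (sym (cong₂ _+_ (cong (⟦_⟧ ∘ is-just) (h-start a<n)) (R-left a)))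
  R-row {a} {suc b} a<n b<n = trans (right≡ (cornerP a<n b<n))
    (cong (λ z → ⟦ z ⟧ + R a (suc b)) (sym (step-right (step a<n b<n))))

  R-col : ∀ {a b} → a < n → b < n → R a (suc b) ≡ ⟦ is-just (w a b) ⟧ + R a b
  R-col {a} {b} a<n b<n = trans (top≡ (cornerP a<n b<n))
    (cong (λ z → ⟦ z ⟧ + R a b) (sym (step-top (step a<n b<n))))

  present : ∀ {m k l} → k ≡ ⟦ is-just m ⟧ + l → k ≡ suc l → is-just {ℕ} m ≡ true
  present e f = ⟦⟧-cancel e f

  absent : ∀ {m k l} → k ≡ ⟦ is-just m ⟧ + l → k ≡ l → is-just {ℕ} m ≡ false
  absent e f = ⟦⟧-cancel e f

  -- Rothe labels outside `Λ`, increasing labels inside; this is carried from the bottom row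
  -- upwards, and through each row from left to right.
  Agrees : ℕ → Set
  Agrees a = (∀ {b} → Λ a ≤ b → b < n → RotheV a b (w a b)) ×
              (∀ {b} → b < Λ a → Between (r a) (w a b) (R a b) (R a (suc b)))

  module _ {a : ℕ} (a<n : a < n) (below : Agrees (suc a)) where

    bottoms : ∀ {b} → b < Λ a → Between (r (suc a)) (w (suc a) b) (R (suc a) b) (R (suc a) (suc b))
    bottoms {b} b<Λ with <-≤-connex b (Λ (suc a))
    ... | inj₁ b<Λ′ = proj₂ below b<Λ′
    -- Between `Λ (suc a)` and `Λ a` the labels from below are Rothe labels, placed correctly
    -- because `R` is `r` there.
    ... | inj₂ Λ′≤b = dot (proj₁ below Λ′≤b b<n)
      where
      b<n = <-≤-trans b<Λ (Λ≤n a)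
      dot : ∀ {m} → RotheV (suc a) b m → Between (r (suc a)) m (R (suc a) b) (R (suc a) (suc b))
      dot (inj₁ (_ , refl)) refl = sym (R-out a<n (<⇒≤ b<n) Λ′≤b) , sym (R-out a<n b<n (m≤n⇒m≤1+n Λ′≤b))
      dot (inj₂ (_ , refl)) ()

    forward : ∀ {b} → b < Λ a → Between (r (suc a)) (h a b) (R a b) (R (suc a) b) →
      Between (r (suc a)) (h a (suc b)) (R a (suc b)) (R (suc a) (suc b)) ×
      Between (r (suc a)) (w a b) (R a b) (R a (suc b))
    forward b<Λ H = let b<n = <-≤-trans b<Λ (Λ≤n a) in
      step-forward (step a<n b<n) (cornerP a<n b<n)
        (noncrossing a<n b<Λ ∘ trans (sym (tileAt-P a<n b<n))) H (bottoms b<Λ)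

    inH : ∀ {b} → b ≤ Λ a → Between (r (suc a)) (h a b) (R a b) (R (suc a) b)
    inH = upward (λ b → Between (r (suc a)) (h a b) (R a b) (R (suc a) b))
      (λ e → case trans (sym (h-start a<n)) e of λ ()) λ b<Λ H → proj₁ (forward b<Λ H)

    R-boundary : R (suc a) (Λ a) ≡ r (suc a) (Λ a)
    R-boundary = R-out a<n (Λ≤n a) (Λ-anti (n≤1+n a))

    R-boundary′ : R a (Λ a) ≡ r a (Λ a)
    R-boundary′ = R-out (<⇒≤ a<n) (Λ≤n a) ≤-refl

    -- Taking `v a` out of the enumeration does not move `x`: once `x` is known not to be `v a`,
    -- `vexillary` gives `x < v a`.
    raise-row : ∀ {b} → b < Λ a → Between (r a) (w a b) (R a b) (R a (suc b))
    raise-row {b} b<Λ {x} e =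
      trans (sym (r-suc-≥ (<⇒≤ x<va))) (proj₁ (W e)) , trans (sym (r-suc-≥ x<va)) (proj₂ (W e))
      where
      b<n = <-≤-trans b<Λ (Λ≤n a)
      W = proj₂ (forward b<Λ (inH (<⇒≤ b<Λ)))
      x<Λ : x < Λ a
      x<Λ = ≤-<-trans (w-bounded (<⇒≤ a<n) b<n e) b<Λ
      ux≤a : u x < suc a
      ux≤a = r-col-inv (trans (proj₂ (W e)) (trans (R-col a<n b<n)
        (trans (cong (λ m → ⟦ is-just m ⟧ + R a b) e) (cong suc (sym (proj₁ (W e)))))))
      -- The label `v a` would need height `r (suc a) (Λ a)` at the right end of its edge, one more
      -- than the heights at the top of row `a` attain within `Λ`.
      ux≢a : u x ≢ a
      ux≢a refl = 1+n≰n (begin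
        suc (r a (Λ a))        ≡⟨ sym (r-suc-< va<Λ) ⟩
        r (suc a) (Λ a)        ≡⟨ sym (r-past-dot va<Λ) ⟩
        r (suc a) (suc (v a))  ≡⟨ cong (r (suc a) ∘ suc) (v∘u x) ⟩
        r (suc a) (suc x)      ≡⟨ proj₂ (W e) ⟩
        R a (suc b)            ≤⟨ R-monoʳ (<⇒≤ a<n) b<Λ (Λ≤n a) ⟩
        R a (Λ a)              ≡⟨ R-boundary′ ⟩
        r a (Λ a)              ∎)
        where
        open ≤-Reasoning
        va<Λ = subst (_< Λ a) (sym (v∘u x)) x<Λ
      x<va : x < v a
      x<va = subst (_< v a) (v∘u x) (vexillary (≤∧≢⇒< (s≤s⁻¹ ux≤a) ux≢a) (subst (_< Λ a) (sym (v∘u x)) x<Λ))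

    -- If `v a < Λ a`, the edge takes the place of the last value below `Λ a`, which is `v a`: a
    -- smaller label comes too early, a larger one too late.
    start : RotheH a (Λ a) (h a (Λ a))
    start with <-≤-connex (v a) (Λ a) | h a (Λ a) | inH ≤-refl | R-row a<n (Λ≤n a)
    ... | inj₂ Λ≤va | nothing | _ | _ = inj₂ (Λ≤va , refl)
    ... | inj₂ Λ≤va | just x  | _ | e =
      contradiction (trans (sym e) (trans R-boundary (trans (r-suc-≥ Λ≤va) (sym R-boundary′)))) 1+n≢n
    ... | inj₁ va<Λ | nothing | _ | e =
      contradiction (trans (sym (r-suc-< va<Λ)) (trans (sym R-boundary) (trans e R-boundary′))) 1+n≢n
    ... | inj₁ va<Λ | just x | H | e with <-cmp x (v a)
    ...   | tri≈ _ refl _ = inj₁ (va<Λ , refl)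
    ...   | tri< x<va _ _ = contradiction (begin
      suc (r a (Λ a))      ≡⟨ cong suc (sym R-boundary′) ⟩
      suc (R a (Λ a))      ≡⟨ sym e ⟩
      R (suc a) (Λ a)      ≡⟨ sym (proj₂ (H refl)) ⟩
      r (suc a) (suc x)    ≤⟨ r-monoʳ (suc a) x<va ⟩
      r (suc a) (v a)      ≡⟨ r-suc-≥ ≤-refl ⟩
      r a (v a)            ≡⟨ r-at-dot va<Λ ⟩
      r a (Λ a)            ∎) 1+n≰n
      where open ≤-Reasoning
    ...   | tri> _ _ va<x = contradiction (begin
      suc (r a (Λ a))        ≡⟨ sym (r-suc-< va<Λ) ⟩
      r (suc a) (Λ a)        ≡⟨ sym (r-past-dot va<Λ) ⟩
      r (suc a) (suc (v a))  ≤⟨ r-monoʳ (suc a) va<x ⟩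
      r (suc a) x            ≡⟨ proj₁ (H refl) ⟩
      R a (Λ a)              ≡⟨ R-boundary′ ⟩
      r a (Λ a)              ∎) 1+n≰n
      where open ≤-Reasoning

    forward-out : ∀ {b} → b < n → Λ a ≤ b → RotheH a b (h a b) → RotheH a (suc b) (h a (suc b)) × RotheV a b (w a b)
    forward-out {b} b<n Λ≤b H = rothe-forward (step a<n b<n) H
      (proj₁ below (≤-trans (Λ-anti (n≤1+n a)) Λ≤b) b<n) rights tops
      where
      Λ≤1+b = m≤n⇒m≤1+n Λ≤b
      R≡r₁ : R (suc a) (suc b) ≡ r (suc a) (suc b)
      R≡r₁ = R-out a<n b<n (≤-trans (Λ-anti (n≤1+n a)) Λ≤1+b)
      R≡r₂ : R a (suc b) ≡ r a (suc b)
      R≡r₂ = R-out (<⇒≤ a<n) b<n Λ≤1+b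
      R≡r₃ : R a b ≡ r a b
      R≡r₃ = R-out (<⇒≤ a<n) (<⇒≤ b<n) Λ≤b
      rights : (v a < suc b × is-just (h a (suc b)) ≡ true) ⊎ (suc b ≤ v a × is-just (h a (suc b)) ≡ false)
      rights with <-≤-connex (v a) (suc b)
      ... | inj₁ va≤b = inj₁ (va≤b , present (R-row a<n b<n) (trans R≡r₁ (trans (r-suc-< va≤b) (cong suc (sym R≡r₂)))))
      ... | inj₂ b<va = inj₂ (b<va , absent (R-row a<n b<n) (trans R≡r₁ (trans (r-suc-≥ b<va) (sym R≡r₂))))
      tops : (u b < a × is-just (w a b) ≡ true) ⊎ (a ≤ u b × is-just (w a b) ≡ false)
      tops with <-≤-connex (u b) a
      ... | inj₁ ub<a = inj₁ (ub<a , present (R-col a<n b<n) (trans R≡r₂ (trans (r-col-< ub<a) (cong suc (sym R≡r₃)))))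
      ... | inj₂ a≤ub = inj₂ (a≤ub , absent (R-col a<n b<n) (trans R≡r₂ (trans (r-col-≥ a≤ub) (sym R≡r₃))))

    outH : ∀ {b} → b ≤ n → Λ a ≤ b → RotheH a b (h a b)
    outH {b} b≤n Λ≤b with m≤n⇒m<n∨m≡n Λ≤b
    ... | inj₂ refl = start
    outH {suc b} b<n Λ≤b | inj₁ Λ<b =
      proj₁ (forward-out b<n (s≤s⁻¹ Λ<b) (outH (<⇒≤ b<n) (s≤s⁻¹ Λ<b)))

    next : Agrees a
    next = (λ Λ≤b b<n → proj₂ (forward-out b<n Λ≤b (outH (<⇒≤ b<n) Λ≤b))) , raise-row

  levels : ∀ {a} → a ≤ n → Agrees a
  levels = downward Agrees
    ((λ _ b<n → inj₁ (u<n b<n , w-bot b<n)) , λ b<Λ → contradiction (subst (_ <_) Λ-n b<Λ) λ ())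
    next

  h-exit : ∀ {a} → a < n → h a n ≡ just (v a)
  h-exit {a} a<n with outH a<n (levels a<n) ≤-refl (Λ≤n a)
  ... | inj₁ (_ , e) = e
  ... | inj₂ (n≤va , _) = contradiction (v<n a<n) (≤⇒≯ n≤va)

  exits : ∀ i → labelℕ (∂ P i) ≡ just (v (toℕ i))
  exits i = trans (sym (h-end i)) (h-exit (toℕ<n i))

-- The shape of a vexillary permutation

extend : ∀ {n} → (Fin n → Fin n) → ℕ → ℕ
extend {n} f a with a <? n
... | yes a<n = toℕ (f (fromℕ< a<n))
... | no _    = a

module _ {n} (f : Fin n → Fin n) where

  extend-in : ∀ {a} (a<n : a < n) → extend f a ≡ toℕ (f (fromℕ< a<n))
  extend-in {a} a<n with a <? n
  ... | yes _   = refl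
  ... | no a≮n  = contradiction a<n a≮n

  extend-out : ∀ {a} → n ≤ a → extend f a ≡ a
  extend-out {a} n≤a with a <? n
  ... | yes a<n = contradiction a<n (≤⇒≯ n≤a)
  ... | no _    = refl

  extend-toℕ : ∀ i → extend f (toℕ i) ≡ toℕ (f i)
  extend-toℕ i = trans (extend-in (toℕ<n i)) (cong (toℕ ∘ f) (fromℕ<-toℕ i (toℕ<n i)))

  extend-< : ∀ {a} → a < n → extend f a < n
  extend-< a<n = subst (_< n) (sym (extend-in a<n)) (toℕ<n _)

extend-inverse : ∀ {n} (f g : Fin n → Fin n) → (∀ i → f (g i) ≡ i) → ∀ a → extend f (extend g a) ≡ a
extend-inverse {n} f g fg a with <-≤-connex a n
... | inj₁ a<n = begin
  extend f (extend g a)            ≡⟨ cong (extend f) (extend-in g a<n) ⟩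
  extend f (toℕ (g (fromℕ< a<n)))  ≡⟨ extend-toℕ f _ ⟩
  toℕ (f (g (fromℕ< a<n)))         ≡⟨ cong toℕ (fg _) ⟩
  toℕ (fromℕ< a<n)                 ≡⟨ toℕ-fromℕ< a<n ⟩
  a                                ∎
  where open ≡-Reasoning
... | inj₂ n≤a = trans (cong (extend f) (extend-out g n≤a)) (extend-out f n≤a)

module PermutationShape {n} (π : Permutation′ n) (vex : Vexillary π) where

  v u Λ : ℕ → ℕ
  v = extend (π ⟨$⟩ʳ_)
  u = extend (π ⟨$⟩ˡ_)
  Λ a = lam π (suc a)

  v∘u : ∀ b → v (u b) ≡ b
  v∘u = extend-inverse _ _ (λ i → inverseʳ π)

  u∘v : ∀ a → u (v a) ≡ a
  u∘v = extend-inverse _ _ (λ i → inverseˡ π)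

  Λ-box : ∀ {a b} → b < Λ a → ∃[ i ] ∃[ j ] (i , j) ∈ Rothe π × a ≤ toℕ i × b ≤ toℕ j
  Λ-box {a} {b} b<Λ with _ , _ , (i , j , box , refl , refl) , (_ , a≤i) , (_ , b≤j) ←
    proj₁ (Y-lam π) {suc a , suc b} (s≤s z≤n , s≤s z≤n , b<Λ) = i , j , box , s≤s⁻¹ a≤i , s≤s⁻¹ b≤j

  Λ-box⁻ : ∀ {a b} i j → (i , j) ∈ Rothe π → a ≤ toℕ i → b ≤ toℕ j → b < Λ a
  Λ-box⁻ {a} {b} i j box a≤i b≤j = proj₂ (proj₂ (proj₂ (Y-lam π) {suc a , suc b}
    (pos i , pos j , (i , j , box , refl , refl) , (s≤s z≤n , s≤s a≤i) , (s≤s z≤n , s≤s b≤j))))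

  Λ-anti : ∀ {a a′} → a ≤ a′ → Λ a′ ≤ Λ a
  Λ-anti {a} {a′} a≤a′ = ≮⇒≥ λ lt → let i , j , box , a′≤i , b≤j = Λ-box lt in
    <-irrefl refl (Λ-box⁻ {a} {Λ a} i j box (≤-trans a≤a′ a′≤i) b≤j)

  Λ≤n : ∀ a → Λ a ≤ n
  Λ≤n a = ≮⇒≥ λ lt → let i , j , box , _ , n≤j = Λ-box lt in <⇒≱ (toℕ<n j) n≤j

  Λ-n : Λ n ≡ 0
  Λ-n = n≤0⇒n≡0 (≮⇒≥ λ lt → let i , j , box , n≤i , _ = Λ-box lt in <⇒≱ (toℕ<n i) n≤i)

  outside : ∀ {a b} → Λ a ≤ b → b < v a → u b ≤ a
  outside {a} {b} Λ≤b b<va = ≮⇒≥ λ a<ub → <⇒≱ (box a<ub) Λ≤b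
    where
    -- From `n` on both extensions are the identity, so `n ≤ a` and `n ≤ b` would give `a < b` and
    -- `b < a`.
    a<n : a < u b → a < n
    a<n a<ub = ≰⇒> λ n≤a → case <-≤-connex b n of λ
      { (inj₁ b<n) → <⇒≱ (<-trans a<ub (extend-< _ b<n)) n≤a
      ; (inj₂ n≤b) → <-asym (subst (a <_) (extend-out _ n≤b) a<ub) (subst (b <_) (extend-out _ n≤a) b<va) }
    box : a < u b → b < Λ a
    box a<ub = Λ-box⁻ i j
      ( subst₂ _<_ (sym (toℕ-fromℕ< b<n)) (extend-in _ (a<n a<ub)) b<va
      , subst₂ _<_ (sym (toℕ-fromℕ< (a<n a<ub))) (extend-in _ b<n) a<ub )
      (≤-reflexive (sym (toℕ-fromℕ< (a<n a<ub)))) (≤-reflexive (sym (toℕ-fromℕ< b<n)))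
      where
      b<n = <-trans b<va (extend-< _ (a<n a<ub))
      i = fromℕ< (a<n a<ub)
      j = fromℕ< b<n

  -- Let `v a < v k`. A box `(i , j)` weakly southeast of `(a , v k)` completes the pattern 2143:
  -- the rows `k`, `a`, `i`, `u j` have the values `v k`, `v a`, `v i`, `j`.
  vexillary : ∀ {k a} → k < a → v k < Λ a → v k < v a
  vexillary {k} {a} k<a vk<Λ with <-cmp (v k) (v a) | Λ-box vk<Λ
  ... | tri< lt _ _ | _ = lt
  ... | tri≈ _ eq _ | _ = contradiction (trans (sym (u∘v k)) (trans (cong u eq) (u∘v a))) (<⇒≢ k<a)
  ... | tri> _ _ va<vk | i , j , (j<πi , i<πj) , a≤i , vk≤j =
    contradiction (πa<πk , πk<j , subst (Fin._< (π ⟨$⟩ʳ i)) (sym (inverseʳ π)) j<πi) (vex k<a′ a<i i<πj)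
    where
    a<n = ≤-<-trans a≤i (toℕ<n i)
    k<n = <-trans k<a a<n
    k<a′ : fromℕ< k<n Fin.< fromℕ< a<n
    k<a′ = subst₂ _<_ (sym (toℕ-fromℕ< k<n)) (sym (toℕ-fromℕ< a<n)) k<a
    πa<πk : (π ⟨$⟩ʳ fromℕ< a<n) Fin.< (π ⟨$⟩ʳ fromℕ< k<n)
    πa<πk = subst₂ _<_ (extend-in _ a<n) (extend-in _ k<n) va<vk
    a<i : fromℕ< a<n Fin.< i
    a<i = subst (_< toℕ i) (sym (toℕ-fromℕ< a<n)) (≤∧≢⇒< a≤i λ { refl →
      <-irrefl (extend-toℕ (π ⟨$⟩ʳ_) i) (<-trans va<vk (≤-<-trans vk≤j j<πi)) })
    πk<j : (π ⟨$⟩ʳ fromℕ< k<n) Fin.< (π ⟨$⟩ʳ (π ⟨$⟩ˡ j))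
    πk<j = subst₂ _<_ (extend-in _ k<n) (cong toℕ (sym (inverseʳ π))) (≤∧≢⇒< vk≤j λ vk≡j →
      <-irrefl (trans (sym (u∘v k)) (trans (cong u vk≡j) (extend-toℕ (π ⟨$⟩ˡ_) j)))
        (<-trans (<-≤-trans k<a a≤i) i<πj))

  shape : Shape n
  shape = record
    { v = v ; u = u ; Λ = Λ ; v∘u = v∘u ; u∘v = u∘v ; v<n = extend-< _ ; u<n = extend-< _
    ; Λ-anti = Λ-anti ; Λ≤n = Λ≤n ; Λ-n = Λ-n ; outside = outside ; vexillary = vexillary }

  open Rank shape public
  open Frontier shape public

  code≡rowSize : ∀ i → code π i ≡ rowSize (toℕ i)
  code≡rowSize i = length-filter-tabulate (λ j → rothe? π (i , j)) (inRow? (toℕ i)) n id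
    (λ j (lt , gt) → subst (toℕ j <_) (sym (extend-toℕ _ i)) lt , subst (toℕ i <_) (sym (extend-toℕ _ j)) gt)
    (λ j (lt , gt) → subst (toℕ j <_) (extend-toℕ _ i) lt , subst (toℕ i <_) (extend-toℕ _ j) gt)

  private
    module S = Sort (Flip.decTotalOrder ≤-decTotalOrder)

    sorted : List ℕ
    sorted = S.sort (List.tabulate (code π))

    sorted-≥ : Linked _≥_ sorted
    sorted-≥ = S.sort-↗ (List.tabulate (code π))

  atLeast-sorted : ∀ y → atLeast y sorted ≡ count (rowSize≥? y) n
  atLeast-sorted y = trans (↭-length (filter-↭ (y ≤?_) (S.sort-↭ (List.tabulate (code π)))))
    (length-filter-tabulate (y ≤?_) (rowSize≥? y) n (code π)
      (λ i le → subst (y ≤_) (code≡rowSize i) le) (λ i le → subst (y ≤_) (sym (code≡rowSize i)) le))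

  mu-anti : ∀ {i j} → i ≤ j → mu π (suc j) ≤ mu π (suc i)
  mu-anti = parts-anti sorted sorted-≥

  mu-frontier-≥ : ∀ {P Q x} → P ≤ n → P ∸ r P Q ≡ suc x → Q ∸ r P Q ≤ mu π (suc x)
  mu-frontier-≥ {P} {Q} {x} P≤n e = parts-≥ sorted x sorted-≥
    (subst₂ _≤_ e (sym (atLeast-sorted _)) (frontier-≥ {P} {Q} P≤n))

  mu-frontier-≤ : ∀ {P Q} → Λ P ≤ Q → Inside P Q → mu π (suc (P ∸ r P Q)) ≤ Q ∸ r P Q
  mu-frontier-≤ {P} {Q} Λ≤Q inside = parts-≤ sorted _ sorted-≥
    (subst (_≤ P ∸ r P Q) (sym (atLeast-sorted _)) (frontier-≤ Λ≤Q inside))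

-- From tableaux to profiles

unit-step : ∀ {x y} → x ≤ y → y ≤ suc x → Σ[ β ∈ Bool ] y ≡ ⟦ β ⟧ + x
unit-step {x} {y} x≤y y≤1+x with m≤n⇒m<n∨m≡n x≤y
... | inj₁ x<y  = true , ≤-antisym y≤1+x x<y
... | inj₂ refl = false , refl

-- Both ways from northwest to southeast gain the same height, which leaves six edge patterns, one
-- for each tile.
edges-corner : ∀ l t b r {nw} → ⟦ r ⟧ + (⟦ t ⟧ + nw) ≡ ⟦ b ⟧ + (⟦ l ⟧ + nw) →
  ∃[ tile ] Corner tile nw (⟦ t ⟧ + nw) (⟦ l ⟧ + nw) (⟦ r ⟧ + (⟦ t ⟧ + nw))
edges-corner false false false false e = blank , mkCorner refl refl refl refl
edges-corner false false true  true  e = down-elbow , mkCorner refl refl refl refl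
edges-corner true  true  false false e = up-elbow , mkCorner refl refl refl refl
edges-corner true  true  true  true  e = crossing , mkCorner refl refl refl refl
edges-corner true  false false true  e = horizontal , mkCorner refl refl refl refl
edges-corner false true  true  false e = vertical , mkCorner refl refl refl refl
edges-corner false false false true  e = contradiction e 1+n≢n
edges-corner false false true  false e = contradiction (sym e) 1+n≢n
edges-corner true  true  false true  e = contradiction e 1+n≢n
edges-corner true  true  true  false e = contradiction (sym e) 1+n≢n
edges-corner true  false false false e = contradiction (sym e) 1+n≢n
edges-corner true  false true  false e = contradiction (≤-reflexive (sym e)) (<⇒≱ (m≤n⇒m≤1+n ≤-refl))
edges-corner true  false true  true  e = contradiction (sym e) 1+n≢n
edges-corner false true  false false e = contradiction e 1+n≢n
edges-corner false true  false true  e = contradiction (≤-reflexive e) (<⇒≱ (m≤n⇒m≤1+n ≤-refl))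
edges-corner false true  true  true  e = contradiction e 1+n≢n

local-corner : ∀ {nw ne sw se} → nw ≤ ne → ne ≤ suc nw → nw ≤ sw → sw ≤ suc nw →
  ne ≤ se → se ≤ suc ne → sw ≤ se → se ≤ suc sw → ∃[ t ] Corner t nw ne sw se
local-corner t₁ t₂ l₁ l₂ r₁ r₂ b₁ b₂
  with t , refl ← unit-step t₁ t₂
  with l , refl ← unit-step l₁ l₂
  with r , refl ← unit-step r₁ r₂
  with b , e ← unit-step b₁ b₂ = edges-corner l t b r e

corner-cong : ∀ {t t′ nw nw′ ne ne′ sw sw′ se se′} → t ≡ t′ → nw ≡ nw′ → ne ≡ ne′ → sw ≡ sw′ → se ≡ se′ →
  Corner t′ nw′ ne′ sw′ se′ → Corner t nw ne sw se
corner-cong refl refl refl refl refl c = c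

record LocalRule (ρ : ℕ → ℕ → ℕ) : Set where
  field
    col-≥ : ∀ a b → ρ a b ≤ ρ a (suc b)
    col-≤ : ∀ a b → ρ a (suc b) ≤ suc (ρ a b)
    row-≥ : ∀ a b → ρ a b ≤ ρ (suc a) b
    row-≤ : ∀ a b → ρ (suc a) b ≤ suc (ρ a b)

  corner-at : ∀ a b → ∃[ t ] Corner t (ρ a b) (ρ a (suc b)) (ρ (suc a) b) (ρ (suc a) (suc b))
  corner-at a b = local-corner (col-≥ a b) (col-≤ a b) (row-≥ a b) (row-≤ a b)
    (row-≥ a (suc b)) (row-≤ a (suc b)) (col-≥ (suc a) b) (col-≤ (suc a) b)

rank-local : ∀ {n} (S : Shape n) → LocalRule (Rank.r S)
rank-local S = record
  { col-≥ = λ a b → r-monoʳ a (n≤1+n b)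
  ; col-≤ = λ a b → ≤-trans (≤-reflexive (r-col a b)) (+-monoˡ-≤ _ (χ≤1 (u b <? a)))
  ; row-≥ = λ a b → m≤n+m _ _
  ; row-≤ = λ a b → +-monoˡ-≤ _ (χ≤1 (v a <? b))
  }
  where
  open Shape S
  open Rank S

pick : ∀ {P A : Set} → Dec P → A → A → A
pick (yes _) x y = x
pick (no _)  x y = y

pick-yes : ∀ {P A : Set} (d : Dec P) {x y : A} → P → pick d x y ≡ x
pick-yes (yes _) _ = refl
pick-yes (no ¬p) p = contradiction p ¬p

pick-no : ∀ {P A : Set} (d : Dec P) {x y : A} → ¬ P → pick d x y ≡ y
pick-no (no _)  _  = refl
pick-no (yes p) ¬p = contradiction p ¬p

-- A positive maximum is not the default value 0, so it is attained.
flag-∈′ : ∀ {n} (π : Permutation′ n) i → 1 ≤ flag π i → (flag π i , flag π i + mu π i ∸ i) ∈ Y (lam π)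
flag-∈′ {n} π i 1≤f with argmax-sel id 0 (filter (λ j → Y? (lam π) (j , j + mu π i ∸ i)) (upTo (suc n)))
... | inj₂ f∈ = proj₂ (∈-filter⁻ (λ j → Y? (lam π) (j , j + mu π i ∸ i)) {xs = upTo (suc n)} f∈)
... | inj₁ f≡0 = contradiction (subst (1 ≤_) f≡0 1≤f) λ ()

module TableauProfile {n} (π : Permutation′ n) (vex : Vexillary π) (T : Tableau π) where
  open PermutationShape π vex

  entry-irrelevant : ∀ {c} p q → entry T (c , p) ≡ entry T (c , q)
  entry-irrelevant p q = ≤-antisym (row-weak T p q ≤-refl) (row-weak T q p ≤-refl)

  row≤entry : ∀ {i j} p → i ≤ entry T ((i , j) , p)
  row≤entry {suc zero}    p = positive T p′
    where p′ = _ , p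
  row≤entry {suc (suc i)} p@(_ , 1≤j , j≤μ) =
    ≤-<-trans (row≤entry p′) (col-strict T p′ p ≤-refl)
    where p′ = s≤s z≤n , 1≤j , ≤-trans j≤μ (mu-anti (n≤1+n i))

  -- The cell in row `t` and column `t - i + j` is weakly northwest of the cell attaining the flag,
  -- which lies in the shape.
  entry-in-lam : ∀ {i j} p → let t = entry T ((i , j) , p) in t + j ≤ i + lam π t
  entry-in-lam {i} {j} p@(1≤i , _ , j≤μ) with entry T ((i , j) , p) | flagged T p | positive T (_ , p)
  ... | suc a | t≤f | _ = begin
    suc a + j                          ≤⟨ m≤n+m∸n (suc a + j) i ⟩
    i + (suc a + j ∸ i)                ≤⟨ +-monoʳ-≤ i (∸-monoˡ-≤ i (+-mono-≤ t≤f j≤μ)) ⟩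
    i + (flag π i + mu π i ∸ i)        ≤⟨ +-monoʳ-≤ i (proj₂ (proj₂ (flag-∈′ π i (≤-trans (s≤s z≤n) t≤f)))) ⟩
    i + lam π (flag π i)               ≤⟨ +-monoʳ-≤ i (lam-anti t≤f) ⟩
    i + lam π (suc a)                  ∎
    where
    open ≤-Reasoning
    lam-anti : ∀ {f} → suc a ≤ f → lam π f ≤ lam π (suc a)
    lam-anti (s≤s a≤f) = Λ-anti a≤f

  -- Boxes in row or column 0 count as filled from the start; this absorbs the
  -- truncated subtractions below.
  Filled : ℕ → ℕ → ℕ → Set
  Filled i j a = i ≡ 0 ⊎ j ≡ 0 ⊎ Σ[ p ∈ Y (mu π) (i , j) ] entry T ((i , j) , p) ≤ a

  filled? : ∀ i j a → Dec (Filled i j a)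
  filled? i j a = (i ≟ 0) ⊎-dec ((j ≟ 0) ⊎-dec inside?)
    where
    inside? : Dec (Σ[ p ∈ Y (mu π) (i , j) ] entry T ((i , j) , p) ≤ a)
    inside? with Y? (mu π) (i , j)
    ... | no ¬p = no (¬p ∘ proj₁)
    ... | yes p = map′ (p ,_) (λ (q , le) → subst (_≤ a) (entry-irrelevant q p) le) (entry T ((i , j) , p) ≤? a)

  filled-box : ∀ {i j a} p → Filled i j a → entry T ((i , j) , p) ≤ a
  filled-box p (inj₂ (inj₂ (q , le))) = subst (_≤ _) (entry-irrelevant q p) le
  filled-box (() , _)     (inj₁ refl)
  filled-box (_ , () , _) (inj₂ (inj₁ refl))

  filled-left : ∀ {i j a} → Filled i (suc j) a → Filled i j a
  filled-left (inj₁ i≡0) = inj₁ i≡0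
  filled-left {j = zero}  (inj₂ (inj₂ _)) = inj₂ (inj₁ refl)
  filled-left {j = suc j} (inj₂ (inj₂ (p@(1≤i , _ , sj≤μ) , le))) = inj₂ (inj₂ (p′ , ≤-trans (row-weak T p′ p (n≤1+n _)) le))
    where p′ = 1≤i , s≤s z≤n , <⇒≤ sj≤μ

  filled-up : ∀ {i j a} → Filled (suc i) j (suc a) → Filled i j a
  filled-up (inj₂ (inj₁ j≡0)) = inj₂ (inj₁ j≡0)
  filled-up {zero}  _ = inj₁ refl
  filled-up {suc i} (inj₂ (inj₂ (p@(_ , 1≤j , j≤μ) , le))) = inj₂ (inj₂ (p′ , s≤s⁻¹ (<-≤-trans (col-strict T p′ p ≤-refl) le)))
    where p′ = s≤s z≤n , 1≤j , ≤-trans j≤μ (mu-anti (n≤1+n i))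

  filled-later : ∀ {i j a} → Filled i j a → Filled i j (suc a)
  filled-later (inj₁ i≡0) = inj₁ i≡0
  filled-later (inj₂ (inj₁ j≡0)) = inj₂ (inj₁ j≡0)
  filled-later (inj₂ (inj₂ (p , le))) = inj₂ (inj₂ (p , m≤n⇒m≤1+n le))

  filled-pred-row : ∀ {i j a} → Filled i j a → Filled (pred i) j a
  filled-pred-row {zero}  f = f
  filled-pred-row {suc i} f = filled-up (filled-later f)

  filled-pred-col : ∀ {i j a} → Filled i j a → Filled i (pred j) a
  filled-pred-col {j = zero}  f = f
  filled-pred-col {j = suc j} f = filled-left f

  filled-∸ : ∀ {i j a} x y → Filled i j a → Filled (i ∸ x) (j ∸ y) a
  filled-∸ {i} {j} {a} zero zero f = f
  filled-∸ {i} {j} {a} (suc x) y f =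
    subst (λ z → Filled z (j ∸ y) a) (pred[m∸n]≡m∸[1+n] i x) (filled-pred-row (filled-∸ x y f))
  filled-∸ {i} {j} {a} zero (suc y) f =
    subst (λ z → Filled i z a) (pred[m∸n]≡m∸[1+n] j y) (filled-pred-col (filled-∸ {i} {j} zero y f))

  filled-smaller : ∀ {i j i′ j′ a} → i ≤ i′ → j ≤ j′ → Filled i′ j′ a → Filled i j a
  filled-smaller {i} {j} {i′} {j′} {a} i≤i′ j≤j′ f = subst₂ (λ x y → Filled x y a)
    (m∸[m∸n]≡n i≤i′) (m∸[m∸n]≡n j≤j′) (filled-∸ (i′ ∸ i) (j′ ∸ j) f)

  -- Rows ≤ a fill exactly the boxes up to (a - M a b , b - M a b) of the diagonal
  -- through (a , b), so M a b of the cells before that corner are not blank.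
  abstract
    M-least : ∀ a b → ∃[ x ] Filled (a ∸ x) (b ∸ x) a × (∀ {y} → Filled (a ∸ y) (b ∸ y) a → x ≤ y)
    M-least a b = least (λ x → filled? (a ∸ x) (b ∸ x) a) a (inj₁ (n∸n≡0 a))

  M : ℕ → ℕ → ℕ
  M a b = proj₁ (M-least a b)

  M-filled : ∀ a b → Filled (a ∸ M a b) (b ∸ M a b) a
  M-filled a b = proj₁ (proj₂ (M-least a b))

  M-minimal : ∀ {a b y} → Filled (a ∸ y) (b ∸ y) a → M a b ≤ y
  M-minimal {a} {b} = proj₂ (proj₂ (M-least a b))

  M≤a : ∀ a b → M a b ≤ a
  M≤a a b = M-minimal (inj₁ (n∸n≡0 a))

  M≤b : ∀ a b → M a b ≤ b
  M≤b a b = M-minimal (inj₂ (inj₁ (n∸n≡0 b)))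

  M-diag : ∀ a b → M (suc a) (suc b) ≤ suc (M a b)
  M-diag a b = M-minimal (filled-later (M-filled a b))

  -- `col-≥` is weak increase along rows and `row-≥` strict increase down columns. The other two use
  -- that filled boxes are closed under moving up or left.
  M-local : LocalRule M
  M-local = record
    { col-≥ = λ a b → M-minimal (col (M a (suc b)) (<-≤-connex b (M a (suc b))) (M-filled a (suc b)))
    ; col-≤ = λ a b → M-minimal (subst (λ z → Filled z (b ∸ M a b) a)
        (pred[m∸n]≡m∸[1+n] a (M a b)) (filled-pred-row (M-filled a b)))
    ; row-≥ = λ a b → M-minimal (row (M (suc a) b) (<-≤-connex a (M (suc a) b)) (M-filled (suc a) b))
    ; row-≤ = λ a b → M-minimal (subst (λ z → Filled (a ∸ M a b) z (suc a))
        (pred[m∸n]≡m∸[1+n] b (M a b)) (filled-pred-col (filled-later (M-filled a b))))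
    }
    where
    col : ∀ {a b} x → b < x ⊎ x ≤ b → Filled (a ∸ x) (suc b ∸ x) a → Filled (a ∸ x) (b ∸ x) a
    col x (inj₁ b<x) f = inj₂ (inj₁ (m≤n⇒m∸n≡0 (<⇒≤ b<x)))
    col {a} {b} x (inj₂ x≤b) f = filled-left (subst (λ z → Filled (a ∸ x) z a) (+-∸-assoc 1 x≤b) f)
    row : ∀ {a b} x → a < x ⊎ x ≤ a → Filled (suc a ∸ x) (b ∸ x) (suc a) → Filled (a ∸ x) (b ∸ x) a
    row x (inj₁ a<x) f = inj₁ (m≤n⇒m∸n≡0 (<⇒≤ a<x))
    row {a} {b} x (inj₂ x≤a) f = filled-up (subst (λ z → Filled z (b ∸ x) (suc a)) (+-∸-assoc 1 x≤a) f)

  -- The box `(P ∸ q , Q ∸ q)` is in the shape of the tableau, and the flags bound its entry by `P`,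
  -- so `M` is at most `q`. A smaller `M` would fill a box beyond the boundary of that shape.
  M-frontier : ∀ {P Q} → P ≤ n → Λ P ≤ Q → Inside P Q → M P Q ≡ r P Q
  M-frontier {P} {Q} P≤n Λ≤Q inside = ≤-antisym (M-minimal (full _ _ refl refl)) (≮⇒≥ M≮q)
    where
    q = r P Q
    q≤P = r≤a P Q
    q≤Q = r≤b P Q

    entry≤P : ∀ {i j} p → i + q ≡ P → j + q ≡ Q → entry T ((i , j) , p) ≤ P
    entry≤P {i} {j} p i+q j+q = ≮⇒≥ λ P<t → 1+n≰n (≤-trans P<t (+-cancelʳ-≤ Q _ _ (bound P<t)))
      where
      open ≤-Reasoning
      t = entry T ((i , j) , p)
      lam≤Q : ∀ {t} → P < t → lam π t ≤ Q
      lam≤Q (s≤s P≤t) = ≤-trans (Λ-anti P≤t) Λ≤Q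
      bound : P < t → t + Q ≤ P + Q
      bound P<t = begin
        t + Q             ≡⟨ cong (t +_) (sym j+q) ⟩
        t + (j + q)       ≡⟨ sym (+-assoc t j q) ⟩
        t + j + q         ≤⟨ +-monoˡ-≤ q (entry-in-lam p) ⟩
        i + lam π t + q   ≤⟨ +-monoˡ-≤ q (+-monoʳ-≤ i (lam≤Q P<t)) ⟩
        i + Q + q         ≡⟨ +-assoc i Q q ⟩
        i + (Q + q)       ≡⟨ cong (i +_) (+-comm Q q) ⟩
        i + (q + Q)       ≡⟨ sym (+-assoc i q Q) ⟩
        i + q + Q         ≡⟨ cong (_+ Q) i+q ⟩
        P + Q             ∎

    full : ∀ i j → P ∸ q ≡ i → Q ∸ q ≡ j → Filled (P ∸ q) (Q ∸ q) P
    full zero    _       e _ = inj₁ e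
    full (suc i) zero    _ e = inj₂ (inj₁ e)
    full (suc i) (suc j) e f = subst₂ (λ x y → Filled x y P) (sym e) (sym f) (inj₂ (inj₂ (p ,
      entry≤P p (trans (cong (_+ q) (sym e)) (m∸n+n≡m q≤P)) (trans (cong (_+ q) (sym f)) (m∸n+n≡m q≤Q)))))
      where
      p : Y (mu π) (suc i , suc j)
      p = s≤s z≤n , s≤s z≤n , subst (_≤ mu π (suc i)) f (mu-frontier-≥ {P} {Q} P≤n e)

    M≮q : ¬ M P Q < q
    M≮q M<q with M-filled P Q
    ... | inj₁ e = <⇒≱ (<-≤-trans M<q q≤P) (m∸n≡0⇒m≤n e)
    ... | inj₂ (inj₁ e) = <⇒≱ (<-≤-trans M<q q≤Q) (m∸n≡0⇒m≤n e)
    ... | inj₂ (inj₂ ((_ , _ , le) , _)) = <⇒≱ (∸-monoʳ-< M<q q≤Q) (begin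
      Q ∸ M P Q              ≤⟨ le ⟩
      mu π (P ∸ M P Q)       ≤⟨ mu-anti′ (∸-monoʳ-< M<q q≤P) ⟩
      mu π (suc (P ∸ q))     ≤⟨ mu-frontier-≤ Λ≤Q inside ⟩
      Q ∸ q                  ∎)
      where
      open ≤-Reasoning
      mu-anti′ : ∀ {x y} → x < y → mu π y ≤ mu π (suc x)
      mu-anti′ (s≤s x≤y) = mu-anti x≤y

  R : ℕ → ℕ → ℕ
  R a b = pick (b <? Λ a) (M a b) (r a b)

  R-out : ∀ {a b} → Λ a ≤ b → R a b ≡ r a b
  R-out {a} {b} Λ≤b = pick-no (b <? Λ a) (≤⇒≯ Λ≤b)

  -- A corner of a cell of `Λ` may lie on the outer boundary, where `R` is `r`; `M-frontier` makes
  -- the two definitions meet there.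
  R-inside : ∀ {a b} → a ≤ n → Inside a b → R a b ≡ M a b
  R-inside {a} {b} a≤n inside with <-≤-connex b (Λ a)
  ... | inj₁ b<Λ = pick-yes (b <? Λ a) b<Λ
  ... | inj₂ Λ≤b = trans (R-out Λ≤b) (sym (M-frontier a≤n Λ≤b inside))

  inside-cell : ∀ {a b} → b < Λ a → ∀ {x y} → x ≤ suc a → y ≤ suc b → Inside x y
  inside-cell b<Λ x≤ y≤ a′<x b′<y =
    ≤-<-trans (s≤s⁻¹ (≤-trans b′<y y≤)) (<-≤-trans b<Λ (Λ-anti (s≤s⁻¹ (≤-trans a′<x x≤))))

  τ : ℕ → ℕ → Tile
  τ a b = pick (b <? Λ a) (proj₁ (LocalRule.corner-at M-local a b)) (proj₁ (LocalRule.corner-at (rank-local shape) a b))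

  corner-in : ∀ {a b} → a < n → b < Λ a → Corner (τ a b) (R a b) (R a (suc b)) (R (suc a) b) (R (suc a) (suc b))
  corner-in {a} {b} a<n b<Λ = corner-cong (pick-yes (b <? Λ a) b<Λ)
    (R-inside (<⇒≤ a<n) (inside-cell b<Λ (n≤1+n a) (n≤1+n b)))
    (R-inside (<⇒≤ a<n) (inside-cell b<Λ (n≤1+n a) ≤-refl))
    (R-inside a<n (inside-cell b<Λ ≤-refl (n≤1+n b)))
    (R-inside a<n (inside-cell b<Λ ≤-refl ≤-refl))
    (proj₂ (LocalRule.corner-at M-local a b))

  corner-out : ∀ {a b} → Λ a ≤ b → Corner (τ a b) (R a b) (R a (suc b)) (R (suc a) b) (R (suc a) (suc b))
  corner-out {a} {b} Λ≤b = corner-cong (pick-no (b <? Λ a) (≤⇒≯ Λ≤b))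
    (R-out Λ≤b) (R-out (m≤n⇒m≤1+n Λ≤b)) (R-out (≤-trans (Λ-anti (n≤1+n a)) Λ≤b))
    (R-out (≤-trans (Λ-anti (n≤1+n a)) (m≤n⇒m≤1+n Λ≤b)))
    (proj₂ (LocalRule.corner-at (rank-local shape) a b))

  profile : Profile shape
  profile = record
    { τ      = τ
    ; R      = R
    ; R-top  = λ {b} _ → R-zero 0 b (n≤0⇒n≡0 (M≤a 0 b)) refl
    ; R-left = λ a → R-zero a 0 (n≤0⇒n≡0 (M≤b a 0)) (r-zeroʳ a)
    ; R-out  = λ _ _ → R-out
    ; corner = λ {a} {b} a<n _ → case <-≤-connex b (Λ a) of λ
        { (inj₁ b<Λ) → corner-in a<n b<Λ ; (inj₂ Λ≤b) → corner-out Λ≤b }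
    ; noncrossing = λ {a} {b} a<n b<Λ t≡ → 1+n≰n (≤-trans (≤-reflexive (sym (crossing-height (corner-in a<n b<Λ) t≡)))
        (subst₂ (λ x y → x ≤ suc y) (sym (R-inside a<n (inside-cell b<Λ ≤-refl ≤-refl)))
          (sym (R-inside (<⇒≤ a<n) (inside-cell b<Λ (n≤1+n a) (n≤1+n b)))) (M-diag a b)))
    }
    where
    R-zero : ∀ a b → M a b ≡ 0 → r a b ≡ 0 → R a b ≡ 0
    R-zero a b m≡0 r≡0 with b <? Λ a
    ... | yes _ = m≡0
    ... | no _  = r≡0
    crossing-height : ∀ {t nw ne sw se} → Corner t nw ne sw se → t ≡ crossing → se ≡ suc (suc nw)
    crossing-height (mkCorner refl _ refl _) refl = refl

-- Blanks of the profile of a tableau.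

module TableauBlanks {n} (π : Permutation′ n) (vex : Vexillary π) (T : Tableau π) where
  open PermutationShape π vex
  open TableauProfile π vex T

  BoxAt : ℕ → ℕ → Set
  BoxAt r c = ∃[ i ] ∃[ j ] ∃[ p ] r ≡ entry T ((i , j) , p) × c + i ≡ r + j

  box-inside : ∀ {a b i j} p → suc a ≡ entry T ((i , j) , p) → suc b + i ≡ suc a + j → b < Λ a
  box-inside {a} {b} {i} {j} p t≡ c≡ = +-cancelʳ-≤ i (suc b) (Λ a) (begin
    suc b + i                               ≡⟨ c≡ ⟩
    suc a + j                               ≡⟨ cong (_+ j) t≡ ⟩
    entry T ((i , j) , p) + j               ≤⟨ entry-in-lam p ⟩
    i + lam π (entry T ((i , j) , p))       ≡⟨ cong (λ t → i + lam π t) (sym t≡) ⟩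
    i + Λ a                                 ≡⟨ +-comm i (Λ a) ⟩
    Λ a + i                                 ∎)
    where open ≤-Reasoning

  R-cell : ∀ {a b} → a < n → b < Λ a → R a b ≡ M a b × R (suc a) (suc b) ≡ M (suc a) (suc b)
  R-cell {a} {b} a<n b<Λ = R-inside (<⇒≤ a<n) (inside-cell b<Λ (n≤1+n a) (n≤1+n b)) ,
                           R-inside a<n (inside-cell b<Λ ≤-refl ≤-refl)

  -- Across a blank `M` stays, so row `suc a` fills one more box of the diagonal: its entry is at
  -- most `suc a` but not at most `a`.
  blank⇒box : ∀ {a b} → a < n → b < n → τ a b ≡ blank → BoxAt (suc a) (suc b)
  blank⇒box {a} {b} a<n b<n t≡ = box (subst₂ (λ i j → Filled i j (suc a)) i≡ j≡ (M-filled (suc a) (suc b)))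
    where
    b<Λ = ProfileProperties.blank-inside profile a<n b<n t≡
    x = M a b
    x≡ : M (suc a) (suc b) ≡ x
    x≡ = trans (sym (proj₂ (R-cell a<n b<Λ))) (trans (corner-blank (corner-in a<n b<Λ) t≡) (proj₁ (R-cell a<n b<Λ)))
    i≡ : suc a ∸ M (suc a) (suc b) ≡ suc (a ∸ x)
    i≡ = trans (cong (suc a ∸_) x≡) (+-∸-assoc 1 (M≤a a b))
    j≡ : suc b ∸ M (suc a) (suc b) ≡ suc (b ∸ x)
    j≡ = trans (cong (suc b ∸_) x≡) (+-∸-assoc 1 (M≤b a b))

    too-early : ∀ x → x ≤ a → x ≤ b → (∀ {y} → Filled (a ∸ y) (b ∸ y) a → x ≤ y) →
      ¬ (Σ[ p ∈ Y (mu π) (suc (a ∸ x) , suc (b ∸ x)) ] entry T (_ , p) ≤ a)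
    -- For height 0 the box is in row `suc a`, where entries exceed `a`.
    too-early zero    _   _   _   (p , le) = 1+n≰n (≤-trans (row≤entry p) le)
    too-early (suc x) x<a x<b min (p , le) = 1+n≰n (min {x} (subst₂ (λ i j → Filled i j a)
      (sym (+-∸-assoc 1 x<a)) (sym (+-∸-assoc 1 x<b)) (inj₂ (inj₂ (p , le)))))

    box : Filled (suc (a ∸ x)) (suc (b ∸ x)) (suc a) → BoxAt (suc a) (suc b)
    box (inj₂ (inj₂ (p , le))) = suc (a ∸ x) , suc (b ∸ x) , p ,
      ≤-antisym (≰⇒> λ t≤a → too-early x (M≤a a b) (M≤b a b) M-minimal (p , t≤a)) le ,
      cong suc (begin
        b + suc (a ∸ x)        ≡⟨ +-suc b _ ⟩
        suc (b + (a ∸ x))      ≡⟨ cong suc (sym (+-∸-assoc b (M≤a a b))) ⟩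
        suc (b + a ∸ x)        ≡⟨ cong (λ z → suc (z ∸ x)) (+-comm b a) ⟩
        suc (a + b ∸ x)        ≡⟨ cong suc (+-∸-assoc a (M≤b a b)) ⟩
        suc (a + (b ∸ x))      ≡⟨ sym (+-suc a _) ⟩
        a + suc (b ∸ x)        ∎)
      where open ≡-Reasoning

  module _ {a b i j : ℕ} (p : Y (mu π) (i , j)) (i≤a : i ≤ a) (diag : b + i ≡ a + j) where

    private
      x = a ∸ i

    row≡ : a ∸ x ≡ i
    row≡ = m∸[m∸n]≡n i≤a

    col≡ : b ∸ x ≡ j
    col≡ = trans (cong (_∸ x) (+-cancelʳ-≡ i _ _ (begin
      b + i             ≡⟨ diag ⟩
      a + j             ≡⟨ +-comm a j ⟩
      j + a             ≡⟨ cong (j +_) (sym (m∸n+n≡m i≤a)) ⟩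
      j + (x + i)       ≡⟨ sym (+-assoc j x i) ⟩
      j + x + i         ∎))) (m+n∸n≡m j x)
      where open ≡-Reasoning

    -- With `M-≤⁻` this recovers the entries from the heights, which also yields injectivity.
    M-≤ : entry T ((i , j) , p) ≤ a → M a b ≤ a ∸ i
    M-≤ t≤a = M-minimal (subst₂ (λ i j → Filled i j a) (sym row≡) (sym col≡) (inj₂ (inj₂ (p , t≤a))))

    M-≤⁻ : M a b ≤ a ∸ i → entry T ((i , j) , p) ≤ a
    M-≤⁻ M≤x = filled-box p (filled-smaller (≤-trans (≤-reflexive (sym row≡)) (∸-monoʳ-≤ a M≤x))
      (≤-trans (≤-reflexive (sym col≡)) (∸-monoʳ-≤ b M≤x)) (M-filled a b))

  box⇒blank : ∀ {a b} → BoxAt (suc a) (suc b) → a < n × b < n × τ a b ≡ blank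
  box⇒blank {a} {b} (i , j , p , t≡ , c≡) = a<n , b<n , corner-blank⁻ (corner-in a<n b<Λ)
    (trans (proj₂ (R-cell a<n b<Λ)) (trans (≤-antisym (≤-trans late (≮⇒≥ early)) mono) (sym (proj₁ (R-cell a<n b<Λ)))))
    where
    b<Λ = box-inside p t≡ c≡
    b<n = <-≤-trans b<Λ (Λ≤n a)
    a<n = Λ-row b<Λ
    mono : M a b ≤ M (suc a) (suc b)
    mono = ≤-trans (LocalRule.row-≥ M-local a b) (LocalRule.col-≥ M-local (suc a) b)
    i≤1+a : i ≤ suc a
    i≤1+a = subst (i ≤_) (sym t≡) (row≤entry p)
    late : M (suc a) (suc b) ≤ suc a ∸ i
    late = M-≤ p i≤1+a c≡ (≤-reflexive (sym t≡))
    early : ¬ M a b < suc a ∸ i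
    early y<x = 1+n≰n (subst (_≤ a) (sym t≡) (M-≤⁻ p i≤a (suc-injective c≡) (s≤s⁻¹ (subst (M a b <_) (+-∸-assoc 1 i≤a) y<x))))
      where
      i≤a : i ≤ a
      i≤a = ≮⇒≥ λ a<i → <⇒≱ y<x (≤-trans (≤-reflexive (m≤n⇒m∸n≡0 a<i)) z≤n)

-- From profiles to tableaux

module ProfileTableau {n} (π : Permutation′ n) (vex : Vexillary π) (prof : Profile (PermutationShape.shape π vex)) where
  open PermutationShape π vex
  open Profile prof
  open ProfileProperties prof

  mu-anti′ : ∀ {i j} → 1 ≤ i → i ≤ j → mu π j ≤ mu π i
  mu-anti′ (s≤s _) (s≤s i≤j) = mu-anti i≤j

  diagonal-end : ∀ a b → ∃[ k ] Λ (k + a) ≤ k + b × (∀ {m} → m < k → m + b < Λ (m + a))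
  diagonal-end a b with least (λ k → Λ (k + a) ≤? k + b) n
    (≤-trans (Λ-anti (m≤m+n n a)) (≤-trans (≤-reflexive Λ-n) z≤n))
  ... | k , out , minimal = k , out , λ m<k → ≰⇒> λ le → <⇒≱ m<k (minimal le)

  -- (a , b) is the last cell of Λ on the diagonal of the box (i , j).
  record BoxEnd (i j : ℕ) : Set where
    field
      {a b}  : ℕ
      inside : b < Λ a
      out    : Λ (suc a) ≤ suc b
      diag   : suc b + i ≡ suc a + j
      rank   : r (suc a) (suc b) + i ≤ suc a

  -- The diagonal of the box is followed from its corner `(i ∸ j , j ∸ i)` on the border until it
  -- leaves `Λ`.
  box-end : ∀ {i j} → Y (mu π) (i , j) → BoxEnd i j
  box-end {i} {j} (1≤i , 1≤j , j≤μ) =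
    let k , out , inside = diagonal-end (i ∸ j) (j ∸ i) in finish k out inside
    where
    diag₀ : j ∸ i + i ≡ i ∸ j + j
    diag₀ with ≤-total i j
    ... | inj₁ i≤j = trans (m∸n+n≡m i≤j) (sym (cong (_+ j) (m≤n⇒m∸n≡0 i≤j)))
    ... | inj₂ j≤i = trans (cong (_+ i) (m≤n⇒m∸n≡0 j≤i)) (sym (m∸n+n≡m j≤i))
    diag′ : ∀ k → k + (j ∸ i) + i ≡ k + (i ∸ j) + j
    diag′ k = trans (+-assoc k _ i) (trans (cong (k +_) diag₀) (sym (+-assoc k _ j)))

    -- Otherwise row `i` comes after the first `P ∸ q` parts, so `j ≤ Q ∸ q`; on the diagonal this
    -- means `q + i ≤ P` after all.
    row-bound : ∀ {P Q} → Λ P ≤ Q → Inside P Q → Q + i ≡ P + j → r P Q + i ≤ P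
    row-bound {P} {Q} out inside e = ≮⇒≥ λ P<q+i → <⇒≱ P<q+i (+-cancelˡ-≤ Q _ _ (begin
      Q + (q + i)       ≡⟨ cong (Q +_) (+-comm q i) ⟩
      Q + (i + q)       ≡⟨ sym (+-assoc Q i q) ⟩
      Q + i + q         ≡⟨ cong (_+ q) e ⟩
      P + j + q         ≡⟨ +-assoc P j q ⟩
      P + (j + q)       ≤⟨ +-monoʳ-≤ P (j+q≤Q P<q+i) ⟩
      P + Q             ≡⟨ +-comm P Q ⟩
      Q + P             ∎))
      where
      open ≤-Reasoning
      q = r P Q
      j+q≤Q : P < q + i → j + q ≤ Q
      j+q≤Q P<q+i = ≤-trans (+-monoˡ-≤ q (≤-trans j≤μ (≤-trans
        (mu-anti′ (s≤s z≤n) (m<n+o⇒m∸n<o P q {i} ⦃ >-nonZero 1≤i ⦄ P<q+i))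
        (mu-frontier-≤ {P} {Q} out inside)))) (≤-reflexive (m∸n+n≡m (r≤b P Q)))

    finish : ∀ k → Λ (k + (i ∸ j)) ≤ k + (j ∸ i) → (∀ {m} → m < k → m + (j ∸ i) < Λ (m + (i ∸ j))) → BoxEnd i j
    -- A diagonal that starts outside `Λ` would give `i ≤ i ∸ j`, impossible for positive `i` and
    -- `j`.
    finish zero    out inside = contradiction (≤-trans (m≤n+m i _) (row-bound out corner-inside (diag′ 0)))
      (<⇒≱ (∸-monoʳ-< {i} 1≤j (j≤i (≤-trans (m≤n+m i _) (row-bound out corner-inside (diag′ 0))))))
      where
      corner-inside : Inside (i ∸ j) (j ∸ i)
      corner-inside {a′} {b′} a′< b′< with ≤-total i j
      ... | inj₁ i≤j = contradiction (subst (a′ <_) (m≤n⇒m∸n≡0 i≤j) a′<) λ ()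
      ... | inj₂ j≤i = contradiction (subst (b′ <_) (m≤n⇒m∸n≡0 j≤i) b′<) λ ()
      j≤i : i ≤ i ∸ j → j ≤ i
      j≤i i≤ = ≮⇒≥ λ i<j → <⇒≱ 1≤i (subst (i ≤_) (m≤n⇒m∸n≡0 (<⇒≤ i<j)) i≤)
    finish (suc k) out inside = record
      { inside = inside ≤-refl ; out = out ; diag = diag′ (suc k)
      ; rank = row-bound out
          (λ a′< b′< → ≤-<-trans (s≤s⁻¹ b′<) (<-≤-trans (inside ≤-refl) (Λ-anti (s≤s⁻¹ a′<)))) (diag′ (suc k)) }

  -- At least as many of the cells on the diagonal in rows ≤ a are blank as there
  -- are boxes up to (i , j) on it.
  Reached : ℕ → ℕ → ℕ → Set
  Reached i j a = R a (a + j ∸ i) + i ≤ a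

  reached? : ∀ i j a → Dec (Reached i j a)
  reached? i j a = R a (a + j ∸ i) + i ≤? a

  column : ∀ a j c i → c + i ≡ a + j → a + j ∸ i ≡ c
  column a j c i e = trans (cong (_∸ i) (sym e)) (m+n∸n≡m c i)

  end-reached : ∀ {i j} (e : BoxEnd i j) → Reached i j (suc (BoxEnd.a e))
  end-reached {i} {j} e = begin
    R (suc a) (suc a + j ∸ i) + i  ≡⟨ cong (λ c → R (suc a) c + i) (column (suc a) j (suc b) i diag) ⟩
    R (suc a) (suc b) + i          ≡⟨ cong (_+ i) (R-out (Λ-row inside) (<-≤-trans inside (Λ≤n a)) out) ⟩
    r (suc a) (suc b) + i          ≤⟨ rank ⟩
    suc a                          ∎
    where
    open BoxEnd e
    open ≤-Reasoning

  abstract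
    first-reached : ∀ {i j} → Y (mu π) (i , j) → ∃[ t ] Reached i j t × (∀ {y} → Reached i j y → t ≤ y)
    first-reached {i} {j} p = least (reached? i j) _ (end-reached (box-end p))

  entryAt : ∀ {i j} → Y (mu π) (i , j) → ℕ
  entryAt p = proj₁ (first-reached p)

  entryAt-reached : ∀ {i j} (p : Y (mu π) (i , j)) → Reached i j (entryAt p)
  entryAt-reached p = proj₁ (proj₂ (first-reached p))

  entryAt-minimal : ∀ {i j} (p : Y (mu π) (i , j)) {y} → Reached i j y → entryAt p ≤ y
  entryAt-minimal p = proj₂ (proj₂ (first-reached p))

  record EntryCell {i j} (p : Y (mu π) (i , j)) : Set where
    field
      {t c}  : ℕ
      entry≡ : entryAt p ≡ suc t
      diag   : suc c + i ≡ suc t + j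
      inside : c < Λ t

  -- The box is reached at its `BoxEnd` at the latest, so the cell of its entry is weakly northwest
  -- of a cell of `Λ`.
  entry-cell : ∀ {i j} (p : Y (mu π) (i , j)) → EntryCell p
  entry-cell {i} {j} p@(1≤i , 1≤j , _) = cell (entryAt p) refl
    where
    open BoxEnd (box-end p)
    cell : ∀ t → entryAt p ≡ t → EntryCell p
    cell zero    e≡ = contradiction (≤-trans (m≤n+m i _) (subst (Reached i j) e≡ (entryAt-reached p))) (<⇒≱ 1≤i)
    cell (suc t) e≡ = found (suc t + j ∸ i) (m∸n+n≡m i≤)
      where
      i≤1+t : i ≤ suc t
      i≤1+t = ≤-trans (m≤n+m i _) (subst (Reached i j) e≡ (entryAt-reached p))
      i≤ : i ≤ suc t + j
      i≤ = ≤-trans i≤1+t (m≤m+n _ j)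
      t≤a : t ≤ a
      t≤a = s≤s⁻¹ (subst (_≤ suc a) e≡ (entryAt-minimal p (end-reached (box-end p))))
      found : ∀ c → c + i ≡ suc t + j → EntryCell p
      found zero    d = contradiction (subst (_≤ suc t) d i≤1+t) (<⇒≱ (m<m+n (suc t) 1≤j))
      found (suc c) d = record { entry≡ = e≡ ; diag = d ; inside = <-≤-trans (≤-<-trans c≤b inside) (Λ-anti t≤a) }
        where
        c≤b : c ≤ b
        c≤b = s≤s⁻¹ (+-cancelʳ-≤ i _ _ (≤-trans (≤-reflexive d) (≤-trans (+-monoˡ-≤ j (s≤s t≤a)) (≤-reflexive (sym diag)))))

  -- In the row where `(i , j′)` is reached, `(i , j)` is reached too, since heights grow to the
  -- right.
  entryAt-row : ∀ {i j j′} (p : Y (mu π) (i , j)) (q : Y (mu π) (i , j′)) → j ≤ j′ → entryAt p ≤ entryAt q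
  entryAt-row {i} {j} {j′} p q j≤j′ = entryAt-minimal p (≤-trans (+-monoˡ-≤ i (R-monoʳ e≤n
      (∸-monoˡ-≤ i (+-monoʳ-≤ (entryAt q) j≤j′)) c≤n)) (entryAt-reached q))
    where
    open EntryCell (entry-cell q)
    e≤n : entryAt q ≤ n
    e≤n = subst (_≤ n) (sym entry≡) (Λ-row inside)
    c≤n : entryAt q + j′ ∸ i ≤ n
    c≤n = subst (_≤ n) (sym (column (entryAt q) j′ (suc c) i (trans diag (cong (_+ j′) (sym entry≡))))) (<-≤-trans inside (Λ≤n t))

  -- If `(suc i , j)` is reached at `(suc t , suc c)`, then `(t , suc c)` is on the diagonal of
  -- `(i , j)` and no higher, so `(i , j)` is reached by row `t`.
  entryAt-col-step : ∀ {i j} (p : Y (mu π) (i , j)) (q : Y (mu π) (suc i , j)) → entryAt p < entryAt q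
  entryAt-col-step {i} {j} p q = subst (entryAt p <_) (sym entry≡) (s≤s (entryAt-minimal p (s≤s⁻¹ (begin
    suc (R t (t + j ∸ i) + i)             ≡⟨ sym (+-suc _ i) ⟩
    R t (t + j ∸ i) + suc i               ≡⟨ cong (λ z → R t z + suc i) (column t j (suc c) i (trans (sym (+-suc c i)) (suc-injective diag))) ⟩
    R t (suc c) + suc i                   ≤⟨ +-monoˡ-≤ (suc i) (R-row-≥ (Λ-row inside) (<-≤-trans inside (Λ≤n t))) ⟩
    R (suc t) (suc c) + suc i             ≡⟨ cong (λ z → R (suc t) z + suc i) (sym (column (suc t) j (suc c) (suc i) diag)) ⟩
    R (suc t) (suc t + j ∸ suc i) + suc i ≤⟨ subst (Reached (suc i) j) entry≡ (entryAt-reached q) ⟩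
    suc t                                 ∎))))
    where
    open EntryCell (entry-cell q)
    open ≤-Reasoning

  entryAt-col : ∀ {i i′ j} (p : Y (mu π) (i , j)) (q : Y (mu π) (i′ , j)) → i < i′ → entryAt p < entryAt q
  entryAt-col {i} {suc m} p@(1≤i , _ , _) q@(_ , 1≤j , j≤μ) i<i′ with m≤n⇒m<n∨m≡n (s≤s⁻¹ i<i′)
  ... | inj₂ refl = entryAt-col-step p q
  ... | inj₁ i<m  = <-trans (entryAt-col p q′ i<m) (entryAt-col-step q′ q)
    where
    1≤m = ≤-trans 1≤i (<⇒≤ i<m)
    q′ = 1≤m , 1≤j , ≤-trans j≤μ (mu-anti′ 1≤m (n≤1+n m))

  -- The last box of row `i` has its cell in `Λ`, on the very diagonal along which the flag is
  -- maximal.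
  entryAt-flagged : ∀ {i j} (p : Y (mu π) (i , j)) → entryAt p ≤ flag π i
  entryAt-flagged {i} {j} p@(1≤i , 1≤j , j≤μ) = ≤-trans (entryAt-row p q j≤μ)
    (subst (_≤ flag π i) (sym entry≡) (flag-upper π i (suc t)
      (s≤s z≤n , subst (1 ≤_) (sym col) (s≤s z≤n) , subst (_≤ Λ t) (sym col) inside)))
    where
    q : Y (mu π) (i , mu π i)
    q = 1≤i , ≤-trans 1≤j j≤μ , ≤-refl
    open EntryCell (entry-cell q)
    col : suc t + mu π i ∸ i ≡ suc c
    col = column (suc t) (mu π i) (suc c) i diag

  tableau : Tableau π
  tableau = record
    { entry      = λ (_ , p) → entryAt p
    ; positive   = λ (_ , p) → let open EntryCell (entry-cell p) in subst (1 ≤_) (sym entry≡) (s≤s z≤n)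
    ; row-weak   = λ p q → entryAt-row p q
    ; col-strict = λ p q → entryAt-col p q
    ; flagged    = λ p → entryAt-flagged p
    }

  open TableauBlanks π vex tableau using (BoxAt)

  box⇒blank : ∀ {a b} → BoxAt (suc a) (suc b) → a < n × b < n × τ a b ≡ blank
  box⇒blank {a} {b} (i , j , p , t≡ , c≡) =
    at-cell (suc-injective (trans t≡ entry≡)) (suc-injective (+-cancelʳ-≡ i (suc b) (suc c)
      (trans c≡ (trans (cong (_+ j) (trans t≡ entry≡)) (sym diag)))))
    where
    open EntryCell (entry-cell p)
    blank-here : t < n × c < n × τ t c ≡ blank
    blank-here = t<n , c<n , corner-blank⁻ (corner t<n c<n)
      (≤-antisym (+-cancelʳ-≤ i _ _ (≤-trans now (≰⇒> before))) (R-diag-≥ t<n c<n))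
      where
      t<n = Λ-row inside
      c<n = <-≤-trans inside (Λ≤n t)
      now : R (suc t) (suc c) + i ≤ suc t
      now = subst (λ z → R (suc t) z + i ≤ suc t) (column (suc t) j (suc c) i diag) (subst (Reached i j) entry≡ (entryAt-reached p))
      before : ¬ (R t c + i ≤ t)
      before le = 1+n≰n (subst (_≤ t) entry≡ (entryAt-minimal p
        (subst (λ z → R t z + i ≤ t) (sym (column t j c i (suc-injective diag))) le)))
    at-cell : a ≡ t → b ≡ c → a < n × b < n × τ a b ≡ blank
    at-cell refl refl = blank-here

  blank⇒box : ∀ {a b} → a < n → b < n → τ a b ≡ blank → BoxAt (suc a) (suc b)
  blank⇒box {a} {b} a<n b<n t≡ = i , j , p , sym (≤-antisym late (≰⇒> early)) , diag
    where
    b<Λ = blank-inside a<n b<n t≡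
    x = R a b
    x≡ : R (suc a) (suc b) ≡ x
    x≡ = corner-blank (corner a<n b<n) t≡
    x≤a : x ≤ a
    x≤a = R≤a (<⇒≤ a<n) (<⇒≤ b<n)
    x≤b : x ≤ b
    x≤b = R≤b (<⇒≤ a<n) (<⇒≤ b<n)
    i = suc (a ∸ x)
    j = suc (b ∸ x)
    x+i : x + i ≡ suc a
    x+i = trans (+-suc x _) (cong suc (m+[n∸m]≡n x≤a))
    x+j : x + j ≡ suc b
    x+j = trans (+-suc x _) (cong suc (m+[n∸m]≡n x≤b))
    diag : suc b + i ≡ suc a + j
    diag = begin
      suc b + i       ≡⟨ cong (_+ i) (sym x+j) ⟩
      x + j + i       ≡⟨ +-assoc x j i ⟩
      x + (j + i)     ≡⟨ cong (x +_) (+-comm j i) ⟩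
      x + (i + j)     ≡⟨ sym (+-assoc x i j) ⟩
      x + i + j       ≡⟨ cong (_+ j) x+i ⟩
      suc a + j       ∎
      where open ≡-Reasoning

    -- Up to the end `(P , Q)` of the diagonal the height grows by at most `k`, so the box is weakly
    -- northwest of `(P ∸ q , Q ∸ q)`, which `mu-frontier-≥` puts in the shape.
    in-shape : ∀ k → Λ (k + suc a) ≤ k + suc b → (∀ {m} → m < k → m + suc b < Λ (m + suc a)) → j ≤ mu π i
    in-shape k out inside = ≤-trans j≤Q∸q (≤-trans (frontier (P ∸ q) refl) (mu-anti′ (s≤s z≤n) i≤P∸q))
      where
      P = k + suc a
      Q = k + suc b
      corner-inside : Inside P Q
      corner-inside = last k inside
        where
        last : ∀ k → (∀ {m} → m < k → m + suc b < Λ (m + suc a)) → Inside (k + suc a) (k + suc b)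
        last zero    _      a′< b′< = ≤-<-trans (s≤s⁻¹ b′<) (<-≤-trans b<Λ (Λ-anti (s≤s⁻¹ a′<)))
        last (suc k) inside a′< b′< = ≤-<-trans (s≤s⁻¹ b′<) (<-≤-trans (inside ≤-refl) (Λ-anti (s≤s⁻¹ a′<)))
      P≤n : P ≤ n
      P≤n = ≮⇒≥ λ n<P → contradiction (subst (0 <_) Λ-n (corner-inside {n} {0} n<P
        (≤-trans (s≤s z≤n) (m≤n+m (suc b) k)))) λ ()
      Q≤n : Q ≤ n
      Q≤n = ≮⇒≥ λ n<Q → <⇒≱ (corner-inside {0} {n} (≤-trans (s≤s z≤n) (m≤n+m (suc a) k)) n<Q) (Λ≤n 0)
      q = r P Q
      q≤ : q ≤ k + x
      q≤ = subst₂ (λ y z → y ≤ k + z) (R-out P≤n Q≤n out) x≡ (R-diag k inside)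
      i≤P∸q : i ≤ P ∸ q
      i≤P∸q = ≤-trans (≤-reflexive (sym (trans (cong (_∸ (k + x)) (trans (cong (k +_) (sym x+i)) (sym (+-assoc k x i)))) (m+n∸m≡n (k + x) i)))) (∸-monoʳ-≤ P q≤)
      j≤Q∸q : j ≤ Q ∸ q
      j≤Q∸q = ≤-trans (≤-reflexive (sym (trans (cong (_∸ (k + x)) (trans (cong (k +_) (sym x+j)) (sym (+-assoc k x j)))) (m+n∸m≡n (k + x) j)))) (∸-monoʳ-≤ Q q≤)
      frontier : ∀ y → P ∸ q ≡ y → Q ∸ q ≤ mu π (P ∸ q)
      frontier zero    e = contradiction (subst (i ≤_) e i≤P∸q) λ ()
      frontier (suc y) e = subst (λ z → Q ∸ q ≤ mu π z) (sym e) (mu-frontier-≥ {P} {Q} P≤n e)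

    p : Y (mu π) (i , j)
    p = let k , out , inside = diagonal-end (suc a) (suc b) in
      s≤s z≤n , s≤s z≤n , in-shape k out inside

    late : entryAt p ≤ suc a
    late = entryAt-minimal p (≤-reflexive (trans (cong (λ z → R (suc a) z + i) (column (suc a) j (suc b) i diag)) (trans (cong (_+ i) x≡) x+i)))

    -- After the entry the height grows by at most one per step, so the box would still be reached
    -- in row `a`, where `x + i ≡ suc a`.
    early : ¬ entryAt p ≤ a
    early e≤a = 1+n≰n (begin
        suc a                             ≡⟨ sym x+i ⟩
        R a b + i                         ≡⟨ cong₂ (λ y z → R y z + i) (sym m+t) (sym m+c) ⟩
        R (m + suc t) (m + suc c) + i     ≤⟨ +-monoˡ-≤ i (R-diag m between) ⟩
        m + R (suc t) (suc c) + i         ≡⟨ +-assoc m _ i ⟩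
        m + (R (suc t) (suc c) + i)       ≤⟨ +-monoʳ-≤ m (subst (λ z → R (suc t) z + i ≤ suc t) (column (suc t) j (suc c) i diag′)
                                               (subst (Reached i j) entry≡ (entryAt-reached p))) ⟩
        m + suc t                         ≡⟨ m+t ⟩
        a                                 ∎)
      where
      open EntryCell (entry-cell p) using (t; c; entry≡) renaming (diag to diag′)
      open ≤-Reasoning
      t<a : suc t ≤ a
      t<a = subst (_≤ a) entry≡ e≤a
      m = a ∸ suc t
      m+t : m + suc t ≡ a
      m+t = m∸n+n≡m t<a
      m+c : m + suc c ≡ b
      m+c = +-cancelʳ-≡ i _ _ (suc-injective (begin-equality
        suc (m + suc c + i)     ≡⟨ cong suc (+-assoc m (suc c) i) ⟩
        suc (m + (suc c + i))   ≡⟨ cong (λ z → suc (m + z)) diag′ ⟩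
        suc (m + (suc t + j))   ≡⟨ cong suc (sym (+-assoc m (suc t) j)) ⟩
        suc (m + suc t + j)     ≡⟨ cong (λ z → suc (z + j)) m+t ⟩
        suc a + j               ≡⟨ sym diag ⟩
        suc b + i               ∎))
      between : ∀ {m′} → m′ < m → m′ + suc c < Λ (m′ + suc t)
      between m′<m = <-≤-trans (≤-<-trans (≤-trans (+-monoˡ-≤ (suc c) (<⇒≤ m′<m)) (≤-reflexive m+c)) b<Λ)
        (Λ-anti (≤-trans (+-monoˡ-≤ (suc t) (<⇒≤ m′<m)) (≤-reflexive m+t)))

-- The bijection

labelℕ-injective : ∀ {n} {l : Label n} {k} → labelℕ l ≡ just (toℕ k) → l ≡ just k
labelℕ-injective {l = just _} e = cong just (toℕ-injective (just-injective e))

blank⇒D : ∀ {n} (P : Tiling n) {a b} → a < n → b < n → tileAt P a b ≡ blank → (suc a , suc b) ∈ blanks P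
blank⇒D P {a} {b} a<n b<n t≡ = fromℕ< a<n , fromℕ< b<n ,
  trans (tile≡tileAt P _ _) (trans (cong₂ (tileAt P) (toℕ-fromℕ< a<n) (toℕ-fromℕ< b<n)) t≡) ,
  cong suc (toℕ-fromℕ< a<n) , cong suc (toℕ-fromℕ< b<n)

D⇒blank : ∀ {n} (P : Tiling n) {a b} → (suc a , suc b) ∈ blanks P → tileAt P a b ≡ blank
D⇒blank P (i , j , t≡ , refl , refl) = trans (sym (tile≡tileAt P i j)) t≡

module Theorem {n} (π : Permutation′ n) (vex : Vexillary π) where
  open PermutationShape π vex
  open TableauBlanks π vex using (BoxAt)

  blanks≐positions : (P : Tiling n) (T : Tableau π) →
    (∀ {a b} → a < n → b < n → tileAt P a b ≡ blank → BoxAt T (suc a) (suc b)) →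
    (∀ {a b} → BoxAt T (suc a) (suc b) → a < n × b < n × tileAt P a b ≡ blank) →
    blanks P ≐ positions T
  blanks≐positions P T to from = (λ { (i , j , t≡ , refl , refl) →
      to (toℕ<n i) (toℕ<n j) (trans (sym (tile≡tileAt P i j)) t≡) }) , λ {x} → back x
    where
    back : ∀ x → x ∈ positions T → x ∈ blanks P
    back (zero , c) (i , j , p , r≡ , _) = contradiction (subst (1 ≤_) (sym r≡) (positive T (_ , p))) λ ()
    back (suc a , zero) (i , j , p@(_ , 1≤j , _) , r≡ , c≡) = contradiction
      (≤-trans (≤-reflexive (sym c≡)) (≤-trans (TableauProfile.row≤entry π vex T p) (≤-reflexive (sym r≡))))
      (<⇒≱ (m<m+n (suc a) 1≤j))
    back (suc a , suc b) box = let a<n , b<n , t≡ = from box in blank⇒D P a<n b<n t≡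

  module _ (T : Tableau π) where
    open TableauProfile π vex T using (profile)
    open Construction shape profile

    toPipe : Pipe π
    toPipe = record
      { tiling   = P
      ; isBPD    = is-BPD
      ; demazure = λ i → labelℕ-injective (trans (exits i) (cong just (extend-toℕ (π ⟨$⟩ʳ_) i)))
      }

    tileAt-toPipe : ∀ {a b} → a < n → b < n → tileAt (tiling toPipe) a b ≡ Profile.τ profile a b
    tileAt-toPipe = tileAt-P

    D-toPipe : D toPipe ≐ positions T
    D-toPipe = blanks≐positions P T
      (λ a<n b<n t≡ → TableauBlanks.blank⇒box π vex T a<n b<n (trans (sym (tileAt-P a<n b<n)) t≡))
      (λ box → let a<n , b<n , t≡ = TableauBlanks.box⇒blank π vex T box in
        a<n , b<n , trans (tileAt-P a<n b<n) t≡)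

  pipeProfile : Pipe π → Profile shape
  pipeProfile P = Analysis.profile shape (isBPD P) λ i →
    trans (cong labelℕ (demazure P i)) (cong just (sym (extend-toℕ (π ⟨$⟩ʳ_) i)))

  pipe-unique : (P Q : Pipe π) → D P ≐ D Q → tiling P ≡ tiling Q
  pipe-unique P Q (P⊆Q , Q⊆P) = tiling-ext (tiling P) (tiling Q)
    (τ-from-R (pipeProfile P) (pipeProfile Q) (R-from-blanks (pipeProfile P) (pipeProfile Q)
      (λ {a} a<n b<Λ t≡ → D⇒blank (tiling Q) (P⊆Q (blank⇒D (tiling P) a<n (<-≤-trans b<Λ (Λ≤n a)) t≡)))
      (λ {a} a<n b<Λ t≡ → D⇒blank (tiling P) (Q⊆P (blank⇒D (tiling Q) a<n (<-≤-trans b<Λ (Λ≤n a)) t≡)))))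

  -- The tableaux agree only pointwise, so the tilings are compared through their blanks.
  toPipe-cong : ∀ {T U : Tableau π} → (∀ b → entry T b ≡ entry U b) → tiling (toPipe T) ≡ tiling (toPipe U)
  toPipe-cong {T} {U} e = pipe-unique (toPipe T) (toPipe U)
    ( (λ d → proj₂ (D-toPipe U) (transfer T U e (proj₁ (D-toPipe T) d)))
    , (λ d → proj₂ (D-toPipe T) (transfer U T (sym ∘ e) (proj₁ (D-toPipe U) d))) )
    where
    transfer : ∀ T U → (∀ b → entry T b ≡ entry U b) → ∀ {x} → x ∈ positions T → x ∈ positions U
    transfer T U e (i , j , p , r≡ , c≡) = i , j , p , trans r≡ (e _) , c≡

  -- Equal tilings have equal blanks, hence equal heights, and `M` at the cell of an entry of `U`
  -- bounds the entry of `T`.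
  entry-≤ : ∀ (T U : Tableau π) → tiling (toPipe T) ≡ tiling (toPipe U) → ∀ b → entry T b ≤ entry U b
  entry-≤ T U eq ((i , j) , p@(_ , 1≤j , _)) = at-entry (entry U (_ , p)) refl
    where
    module T = TableauProfile π vex T
    module U = TableauProfile π vex U
    τ≡ : ∀ {a b} → a < n → b < n → T.τ a b ≡ U.τ a b
    τ≡ {a} {b} a<n b<n = trans (sym (tileAt-toPipe T a<n b<n))
      (trans (cong (λ P → tileAt P a b) eq) (tileAt-toPipe U a<n b<n))
    at-entry : ∀ t → entry U (_ , p) ≡ t → entry T (_ , p) ≤ t
    at-entry zero    t≡ = contradiction (subst (1 ≤_) t≡ (positive U (_ , p))) λ ()
    at-entry (suc a) t≡ = TableauBlanks.M-≤⁻ π vex T p i≤1+a diag (subst (_≤ suc a ∸ i) M≡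
      (TableauBlanks.M-≤ π vex U p i≤1+a diag (≤-reflexive t≡)))
      where
      i≤1+a : i ≤ suc a
      i≤1+a = subst (i ≤_) t≡ (U.row≤entry p)
      b = a + j ∸ i
      diag : suc b + i ≡ suc a + j
      diag = cong suc (m∸n+n≡m (≤-trans i≤1+a (≤-trans (≤-reflexive (+-comm 1 a)) (+-monoʳ-≤ a 1≤j))))
      b<Λ : b < Λ a
      b<Λ = TableauBlanks.box-inside π vex U p (sym t≡) diag
      a<n : a < n
      a<n = Λ-row b<Λ
      M≡ : U.M (suc a) (suc b) ≡ T.M (suc a) (suc b)
      M≡ = trans (sym (proj₂ (TableauBlanks.R-cell π vex U a<n b<Λ))) (trans (sym (R-from-blanks T.profile U.profile
        (λ {a} a<n b<Λ → trans (sym (τ≡ a<n (<-≤-trans b<Λ (Λ≤n a)))))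
        (λ {a} a<n b<Λ → trans (τ≡ a<n (<-≤-trans b<Λ (Λ≤n a)))) a<n (<-≤-trans b<Λ (Λ≤n a))))
        (proj₂ (TableauBlanks.R-cell π vex T a<n b<Λ)))

  toTableau : Pipe π → Tableau π
  toTableau P = ProfileTableau.tableau π vex (pipeProfile P)

  D-toTableau : ∀ P → D P ≐ positions (toTableau P)
  D-toTableau P = blanks≐positions (tiling P) (toTableau P)
    (ProfileTableau.blank⇒box π vex (pipeProfile P)) (ProfileTableau.box⇒blank π vex (pipeProfile P))

  pipe-from-positions : ∀ (P : Pipe π) T → D P ≐ positions T → tiling P ≡ tiling (toPipe T)
  pipe-from-positions P T (D⊆ , ⊆D) = pipe-unique P (toPipe T)
    ((λ d → proj₂ (D-toPipe T) (D⊆ d)) , λ d → ⊆D (proj₁ (D-toPipe T) d))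

  γ : Bijection (FSYT π) (Pipes π)
  γ = record
    { to        = toPipe
    ; cong      = λ {T} {U} → toPipe-cong {T} {U}
    ; bijective = (λ {T} {U} eq b → ≤-antisym (entry-≤ T U eq b) (entry-≤ U T (sym eq) b)) ,
        λ P → toTableau P , λ {T} e → trans (toPipe-cong {T} {toTableau P} e)
          (sym (pipe-from-positions P (toTableau P) (D-toTableau P)))
    }

theorem7p7 : ∀ {n} (v : Permutation′ n) → Vexillary v →
    Σ[ γ ∈ Bijection (FSYT v) (Pipes v) ]
    (∀ T → D (Bijection.to γ T) ≐ positions T
    × (∀ P → D P ≐ positions T → Setoid._≈_ (Pipes v) P (Bijection.to γ T)))
theorem7p7 v vex = γ , λ T → D-toPipe T , λ P → pipe-from-positions P T
  where open Theorem v vex
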